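{- Almost all graphs $G$ have a $\chi_{harm}$-mate; i.e. the harmonious polynomial $\chi_{harm}$ is weakly distinguishing.
   Context: All graphs are finite and simple. For $k\in\mathbb{N}$, a harmonious colouring of $G$ with $k$ colours is a map $f:V(G)\to[k]$ that is a proper colouring and such that for all $i,j\in[k]$ the induced subgraph $G[f^{ -1}(i)\cup f^{ -1}(j)]$ has at most one edge. $\chi_{harm}(G;\lambda)$ denotes the number of harmonious colourings of $G$ with $\lambda$ colours; it is a polynomial in $\lambda$. For a graph polynomial $P$, $H$ is a $P$-mate of $G$ if $P(G)=P(H)$ but $H\not\cong G$; $G$ is $P$-unique if it has no $P$-mate. Let $\mathcal{G}(n)$ be the set of isomorphism classes of graphs on $n$ vertices and $U_P(n)$ the set of $P$-unique graphs in $\mathcal{G}(n)$; $P$ is weakly distinguishing if $\lim_{n\to\infty}|U_P(n)|/|\mathcal{G}(n)|=0$. -}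

module Defs where

open import Data.Bool using (Bool; T; T?)
open import Data.Fin using (Fin; finToFun)
open import Data.Fin.Properties using (_≟_; all?)
open import Data.Integer using (+_)
open import Data.List using (length; filter; allFin)
open import Data.Nat using (ℕ; _^_; _≥_; NonZero)
open import Data.Product using (Σ; ∃-syntax; _×_; _,_; proj₁)
open import Data.Rational using (ℚ; 0ℚ; _<_; _-_; ∣_∣; _/_)
open import Data.Sum using (_⊎_)
open import Function using (_∘_)
open import Function.Bundles using (_↔_; module Inverse; Bijection)
open import Function.Construct.Composition using (_↔-∘_)
open import Function.Construct.Identity using (↔-id)
open import Function.Construct.Symmetry using (↔-sym)
open import Level using (0ℓ)
open import Relation.Binary.Bundles using (Setoid)
import Relation.Binary.Construct.On as On
open import Relation.Binary.PropositionalEquality using (_≡_; _≢_; _≗_; refl; sym; trans; cong₂; setoid)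
open import Relation.Nullary using (¬_; Dec; ¬?; _×-dec_; _⊎-dec_; _→-dec_)

record Graph (n : ℕ) : Set where
  field
    adj       : Fin n → Fin n → Bool
    symmetric : ∀ u v → adj u v ≡ adj v u
    loopless  : ∀ u → ¬ T (adj u u)

  Adj : Fin n → Fin n → Set
  Adj u v = T (adj u v)

open Graph public

infix 4 _≅_

_≅_ : ∀ {m n} → Graph m → Graph n → Set
_≅_ {m} {n} G H =
  Σ (Fin m ↔ Fin n) λ φ → ∀ u v → adj G u v ≡ adj H (Inverse.to φ u) (Inverse.to φ v)

≅-refl : ∀ {n} {G : Graph n} → G ≅ G
≅-refl = ↔-id _ , λ _ _ → refl

≅-sym : ∀ {m n} {G : Graph m} {H : Graph n} → G ≅ H → H ≅ G
≅-sym {G = G} {H} (φ , p) = ↔-sym φ , λ u v →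
  sym (trans (p (φ.from u) (φ.from v))
             (cong₂ (adj H) (φ.strictlyInverseˡ u) (φ.strictlyInverseˡ v)))
  where module φ = Inverse φ

≅-trans : ∀ {l m n} {G : Graph l} {H : Graph m} {K : Graph n} → G ≅ H → H ≅ K → G ≅ K
≅-trans (φ , p) (ψ , q) =
  ψ ↔-∘ φ , λ u v → trans (p u v) (q (Inverse.to φ u) (Inverse.to φ v))

-- 𝒢(n): the isomorphism classes are the elements of this setoid.
𝒢 : ℕ → Setoid 0ℓ 0ℓ
𝒢 n = record
  { Carrier       = Graph n
  ; _≈_           = _≅_
  ; isEquivalence = record
    { refl  = λ {G} → ≅-refl {G = G}
    ; sym   = λ {G H} → ≅-sym {G = G} {H}
    ; trans = λ {G H K} → ≅-trans {G = G} {H} {K}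
    }
  }

module _ {n : ℕ} (G : Graph n) {k : ℕ} (f : Fin n → Fin k) where

  Proper : Set
  Proper = ∀ u v → Adj G u v → f u ≢ f v

  -- u v is an edge of the induced subgraph G[f⁻¹(i) ∪ f⁻¹(j)].
  InducedEdge : Fin k → Fin k → Fin n → Fin n → Set
  InducedEdge i j u v = (f u ≡ i ⊎ f u ≡ j) × (f v ≡ i ⊎ f v ≡ j) × Adj G u v

  AtMostOneEdge : Fin k → Fin k → Set
  AtMostOneEdge i j = ∀ u v x y → InducedEdge i j u v → InducedEdge i j x y →
                      (u ≡ x × v ≡ y) ⊎ (u ≡ y × v ≡ x)

  Harmonious : Set
  Harmonious = Proper × (∀ i j → AtMostOneEdge i j)

  proper? : Dec Proper
  proper? = all? λ u → all? λ v → T? (adj G u v) →-dec ¬? (f u ≟ f v)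

  inducedEdge? : ∀ i j u v → Dec (InducedEdge i j u v)
  inducedEdge? i j u v =
    ((f u ≟ i) ⊎-dec (f u ≟ j)) ×-dec ((f v ≟ i) ⊎-dec (f v ≟ j)) ×-dec T? (adj G u v)

  atMostOneEdge? : ∀ i j → Dec (AtMostOneEdge i j)
  atMostOneEdge? i j = all? λ u → all? λ v → all? λ x → all? λ y →
    inducedEdge? i j u v →-dec (inducedEdge? i j x y →-dec
      (((u ≟ x) ×-dec (v ≟ y)) ⊎-dec ((u ≟ y) ×-dec (v ≟ x))))

  harmonious? : Dec Harmonious
  harmonious? = proper? ×-dec (all? λ i → all? λ j → atMostOneEdge? i j)

-- A graph polynomial is represented by its values at the natural numbers, which
-- determine a polynomial; equality of polynomials is thus pointwise equality _≗_.
GraphPolynomial : Set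
GraphPolynomial = ∀ {n} → Graph n → ℕ → ℕ

-- finToFun is a bijection from Fin (k ^ n) to the maps Fin n → Fin k (up to _≗_).
χ-harm : GraphPolynomial
χ-harm {n} G k = length (filter (harmonious? G ∘ finToFun {k} {n}) (allFin (k ^ n)))

module _ (P : GraphPolynomial) where

  IsMate : ∀ {m n} → Graph m → Graph n → Set
  IsMate H G = P G ≗ P H × ¬ (H ≅ G)

  Unique : ∀ {n} → Graph n → Set
  Unique G = ¬ (∃[ m ] Σ (Graph m) λ H → IsMate H G)

  U : ℕ → Setoid 0ℓ 0ℓ
  U n = On.setoid {B = Σ (Graph n) Unique} (𝒢 n) proj₁

HasCardinality : Setoid 0ℓ 0ℓ → ℕ → Set
HasCardinality S k = Bijection (setoid (Fin k)) S

ConvergesTo : (ℕ → ℚ) → ℚ → Set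
ConvergesTo a L = ∀ ε → 0ℚ < ε → ∃[ N ] ∀ n → n ≥ N → ∣ a n - L ∣ < ε

-- The cardinalities of U_P(n) and 𝒢(n) are unique when they exist; their
-- existence is part of the claim.
record WeaklyDistinguishing (P : GraphPolynomial) : Set where
  field
    ∣U∣ ∣𝒢∣      : ℕ → ℕ
    ∣U∣-correct  : ∀ n → HasCardinality (U P n) (∣U∣ n)
    ∣𝒢∣-correct  : ∀ n → HasCardinality (𝒢 n) (∣𝒢∣ n)
    ∣𝒢∣-nonZero  : ∀ n → NonZero (∣𝒢∣ n)
    ratio→0      : ConvergesTo (λ n → _/_ (+ ∣U∣ n) (∣𝒢∣ n) {{∣𝒢∣-nonZero n}}) 0ℚ

-- In a graph of diameter at most two, a harmonious colouring is the same thing as an injective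
-- one, so all such graphs on n vertices share one polynomial, and for n ≥ 3 each of them has a
-- mate (a complete graph or a star).  It remains to see that isomorphism classes of graphs of
-- larger diameter are rare.  Burnside's counting of pairs (graph, automorphism) transfers the
-- question to labelled graphs: the identity contributes the labelled graphs of diameter > 2, a
-- fraction O(n² (3/4)ⁿ), and an automorphism moving k vertices moves at least k(n-2)/2 pairs of
-- vertices, hence fixes at most a fraction 2^(-k(n-2)/4) of the graphs.  Summing the latter over
-- all self-maps of the vertex set, weighted by X^(-k) with X = 2^e and e ≤ (n-2)/4, factorises
-- over the vertices to at most (1 + n/X)ⁿ, where the identity accounts for 1.
--
-- The number of unique graphs exists constructively because uniqueness is decidable: the j-th
-- difference of the polynomial counts colourings that use j prescribed colours, so it vanishes
-- for j > n, and the polynomial (and also n) is determined by finitely many values.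

module Submission where

open import Defs

open import Data.Bool using (Bool; true; false; T; T?; not; if_then_else_)
import Data.Bool.Properties as Bool
open import Data.Fin as Fin using (Fin; zero; suc; toℕ; fromℕ<; finToFun; funToFin; punchIn; punchOut; inject≤; _↑ˡ_; _↑ʳ_; splitAt)
open import Data.Fin.Induction using (<-wellFounded; >-wellFounded)
open import Data.Fin.Properties as Fin using (_≟_; all?; ¬∀⟶∃¬; toℕ<n; toℕ-fromℕ<; toℕ-injective; toℕ-inject≤; inject≤-injective; splitAt-↑ˡ; splitAt-↑ʳ; splitAt⁻¹-↑ˡ; splitAt⁻¹-↑ʳ; funToFin-finToFin; finToFun-funToFin; punchIn-injective; punchInᵢ≢i; punchIn-punchOut; injective⇒≤)
import Data.Integer as ℤ
import Data.Integer.Properties as ℤ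
open import Data.List as List using (List; []; _∷_; _++_; [_]; map; length; filter; allFin; cartesianProduct; cartesianProductWith; tabulate; deduplicate)
open import Data.List.Membership.Propositional using (_∈_; lose; find)
open import Data.List.Membership.Propositional.Properties
import Data.List.Membership.Setoid.Properties as SetoidMembership
open import Data.List.Properties using (length-++; length-map; length-tabulate; map-tabulate; map-∘; map-cong; filter-none)
open import Data.List.Relation.Unary.All as All using ([]; _∷_)
open import Data.List.Relation.Unary.AllPairs using (AllPairs; []; _∷_)
open import Data.List.Relation.Unary.Any as Any using (Any; here; there)
open import Data.List.Relation.Unary.Any.Properties using (map⁺; lookup-index)
open import Data.List.Relation.Unary.Unique.DecSetoid.Properties using (deduplicate-!)
open import Data.List.Relation.Unary.Unique.Propositional using () renaming (Unique to Distinct)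
import Data.List.Relation.Unary.Unique.Propositional.Properties as Distinct
open import Data.Maybe as Maybe using (Maybe; just; nothing; maybe′; fromMaybe)
open import Data.Nat using (ℕ; zero; suc; _+_; _*_; _∸_; _^_; _≤_; _<_; z≤n; s≤s; _<?_; NonZero; >-nonZero; >-nonZero⁻¹; _/_; _%_)
open import Data.Nat.DivMod using (m≡m%n+[m/n]*n; m%n<n; m/n*n≤m; /-monoˡ-≤; m*n/n≡m)
open import Data.Nat.ListAction using (sum; product)
open import Data.Nat.Properties as ℕ hiding (_≟_)
open import Data.Nat.Solver using (module +-*-Solver)
open import Data.Product as Product using (Σ; ∃; _×_; _,_; proj₁; proj₂)
open import Data.Rational as ℚ using (ℚ; 0ℚ; mkℚ)
import Data.Rational.Properties as ℚ
open import Data.Rational.Unnormalised as ℚᵘ using (mkℚᵘ)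
import Data.Rational.Unnormalised.Properties as ℚᵘ
open import Data.Sum as Sum using (_⊎_; inj₁; inj₂; [_,_]′)
open import Data.Vec as Vec using (Vec; []; _∷_; lookup)
import Data.Vec.Properties as Vec
open import Function using (_∘_; id)
open import Function.Bundles using (mk↔ₛ′; module Inverse; module Bijection)
open import Induction.WellFounded using (WellFounded; Acc; acc)
open import Level using (0ℓ)
open import Relation.Binary.Bundles using (Setoid; DecSetoid)
open import Relation.Binary.Core using (Rel)
open import Relation.Binary.Definitions using (tri<; tri≈; tri>)
open import Relation.Binary.PropositionalEquality using (_≡_; _≢_; _≗_; refl; sym; trans; cong; cong₂; subst; subst₂; module ≡-Reasoning)
open import Relation.Nullary using (¬_; Dec; yes; no; does; ¬?; contradiction; map′; _×-dec_; _→-dec_; _⊎-dec_)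
open import Relation.Unary using (Pred; Decidable)

-- Counting by relations and injections between lists

private
  variable
    A B C : Set

-- Induction on `xs`: a partner `y` of the head is cut out of `ys`, and by the uniqueness condition
-- no later entry can have `y` as its partner. A relation is taken rather than a function, so that
-- partners may be described without being computed.
length-≤-relation : (xs : List A) (ys : List B) (R : A → B → Set) → Distinct xs →
  (∀ {x} → x ∈ xs → ∃ λ y → y ∈ ys × R x y) →
  (∀ {x x′ y} → x ∈ xs → x′ ∈ xs → R x y → R x′ y → x ≡ x′) → length xs ≤ length ys
length-≤-relation [] ys R d total inj = z≤n
length-≤-relation (x ∷ xs) ys R (x∉ ∷ d) total inj with total (here refl)
... | y , y∈ , xRy with ∈-∃++ y∈
... | as , bs , refl = begin
  suc (length xs)              ≤⟨ s≤s (length-≤-relation xs (as ++ bs) R d total′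
      (λ p q → inj (there p) (there q))) ⟩
  suc (length (as ++ bs))      ≡⟨ cong suc (length-++ as) ⟩
  suc (length as + length bs)  ≡⟨ sym (+-suc (length as) (length bs)) ⟩
  length as + suc (length bs)  ≡⟨ sym (length-++ as) ⟩
  length (as ++ [ y ] ++ bs)   ∎
  where
  open ≤-Reasoning
  total′ : ∀ {x′} → x′ ∈ xs → ∃ λ y′ → y′ ∈ as ++ bs × R x′ y′
  total′ x′∈ with total (there x′∈)
  ... | y′ , y′∈ , x′Ry′ with ∈-++⁻ as y′∈
  ... | inj₁ p           = y′ , ∈-++⁺ˡ p , x′Ry′
  ... | inj₂ (there p)   = y′ , ∈-++⁺ʳ as p , x′Ry′
  ... | inj₂ (here refl) = contradiction (inj (here refl) (there x′∈) xRy x′Ry′) (All.lookup x∉ x′∈)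

length-≤-injection : (xs : List A) (ys : List B) (f : A → B) → Distinct xs →
  (∀ {x} → x ∈ xs → f x ∈ ys) → (∀ {x y} → x ∈ xs → y ∈ xs → f x ≡ f y → x ≡ y) →
  length xs ≤ length ys
length-≤-injection xs ys f d into inj = length-≤-relation xs ys (λ x y → f x ≡ y) d
  (λ x∈ → f _ , into x∈ , refl) (λ p q eq eq′ → inj p q (trans eq (sym eq′)))

length-cartesianProductWith : (f : A → B → C) (xs : List A) (ys : List B) →
  length (cartesianProductWith f xs ys) ≡ length xs * length ys
length-cartesianProductWith f []       ys = refl
length-cartesianProductWith f (x ∷ xs) ys = trans (length-++ (map (f x) ys))
  (cong₂ _+_ (length-map (f x) ys) (length-cartesianProductWith f xs ys))

length-cartesianProduct : (xs : List A) (ys : List B) →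
  length (cartesianProduct xs ys) ≡ length xs * length ys
length-cartesianProduct = length-cartesianProductWith _,_

module _ {P : Pred A 0ℓ} (P? : Decidable P) where

  length-filter-¬ : ∀ xs → length (filter (¬? ∘ P?) xs) + length (filter P? xs) ≡ length xs
  length-filter-¬ [] = refl
  length-filter-¬ (x ∷ xs) with P? x
  ... | yes _ = trans (+-suc _ _) (cong suc (length-filter-¬ xs))
  ... | no  _ = cong suc (length-filter-¬ xs)

count-≤ : {P Q : Pred A 0ℓ} (P? : Decidable P) (Q? : Decidable Q) {xs : List A} → Distinct xs →
  (∀ {x} → P x → Q x) → length (filter P? xs) ≤ length (filter Q? xs)
count-≤ P? Q? {xs} d P⇒Q = length-≤-injection _ (filter Q? xs) id (Distinct.filter⁺ P? d)
  (λ x∈ → let x∈xs , px = ∈-filter⁻ P? {xs = xs} x∈ in ∈-filter⁺ Q? x∈xs (P⇒Q px)) (λ _ _ eq → eq)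

length-≤-cover : (xs : List A) (ys : List B) (g : B → A) → Distinct xs →
  (∀ {x} → x ∈ xs → ∃ λ y → y ∈ ys × g y ≡ x) → length xs ≤ length ys
length-≤-cover xs ys g d cover = length-≤-relation xs ys (λ x y → g y ≡ x) d cover
  (λ _ _ eq eq′ → trans (sym eq) eq′)

count-≡-bijection : {P : Pred A 0ℓ} {Q : Pred B 0ℓ} (P? : Decidable P) (Q? : Decidable Q)
  {xs : List A} {ys : List B} → Distinct xs → Distinct ys → (g : B → A) →
  (∀ {y z} → g y ≡ g z → y ≡ z) → (∀ {y} → Q y → g y ∈ xs × P (g y)) →
  (∀ {x} → P x → ∃ λ y → (y ∈ ys × Q y) × g y ≡ x) → length (filter P? xs) ≡ length (filter Q? ys)
count-≡-bijection P? Q? {xs} {ys} dx dy g inj into cover = ≤-antisym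
  (length-≤-cover (filter P? xs) (filter Q? ys) g (Distinct.filter⁺ P? dx) λ x∈ →
    let y , (y∈ , qy) , eq = cover (proj₂ (∈-filter⁻ P? {xs = xs} x∈)) in y , ∈-filter⁺ Q? y∈ qy , eq)
  (length-≤-injection (filter Q? ys) (filter P? xs) g (Distinct.filter⁺ Q? dy)
    (λ y∈ → let gy∈ , p = into (proj₂ (∈-filter⁻ Q? {xs = ys} y∈)) in ∈-filter⁺ P? gy∈ p)
    (λ _ _ → inj))

count-cong : {P Q : Pred A 0ℓ} (P? : Decidable P) (Q? : Decidable Q) {xs : List A} → Distinct xs →
  (∀ {x} → P x → Q x) → (∀ {x} → Q x → P x) → length (filter P? xs) ≡ length (filter Q? xs)
count-cong P? Q? d P⇒Q Q⇒P = ≤-antisym (count-≤ P? Q? d P⇒Q) (count-≤ Q? P? d Q⇒P)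

count-split : {P Q : Pred A 0ℓ} (P? : Decidable P) (Q? : Decidable Q) (xs : List A) →
  length (filter P? xs) ≡
  length (filter (λ x → P? x ×-dec Q? x) xs) + length (filter (λ x → P? x ×-dec ¬? (Q? x)) xs)
count-split P? Q? [] = refl
count-split P? Q? (x ∷ xs) with P? x | Q? x
... | yes _ | yes _ = cong suc (count-split P? Q? xs)
... | yes _ | no  _ = trans (cong suc (count-split P? Q? xs)) (sym (+-suc _ _))
... | no  _ | yes _ = count-split P? Q? xs
... | no  _ | no  _ = count-split P? Q? xs

module _ {P : Pred A 0ℓ} (P? : Decidable P) where

  filterΣ : List A → List (Σ A P)
  filterΣ [] = []
  filterΣ (x ∷ xs) with P? x
  ... | yes p = (x , p) ∷ filterΣ xs
  ... | no  _ = filterΣ xs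

  -- Only first components are compared, since the proof that `P?` returns may differ from the given
  -- one.
  ∈-filterΣ : ∀ {x xs} → x ∈ xs → P x → Any (λ p → proj₁ p ≡ x) (filterΣ xs)
  ∈-filterΣ {xs = x ∷ xs} (here refl) px with P? x
  ... | yes p = here refl
  ... | no ¬p = contradiction px ¬p
  ∈-filterΣ {xs = x ∷ xs} (there x∈) px with P? x
  ... | yes _ = there (∈-filterΣ x∈ px)
  ... | no  _ = ∈-filterΣ x∈ px

length-filter-map : {P : Pred B 0ℓ} (P? : Decidable P) (f : A → B) (xs : List A) →
  length (filter P? (map f xs)) ≡ length (filter (P? ∘ f) xs)
length-filter-map P? f [] = refl
length-filter-map P? f (x ∷ xs) with P? (f x)
... | yes _ = cong suc (length-filter-map P? f xs)
... | no  _ = length-filter-map P? f xs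

length-filter-++ : {P : Pred A 0ℓ} (P? : Decidable P) (xs ys : List A) →
  length (filter P? (xs ++ ys)) ≡ length (filter P? xs) + length (filter P? ys)
length-filter-++ P? [] ys = refl
length-filter-++ P? (x ∷ xs) ys with P? x
... | yes _ = cong suc (length-filter-++ P? xs ys)
... | no  _ = length-filter-++ P? xs ys

-- Finite sums

∑ : List A → (A → ℕ) → ℕ
∑ xs f = sum (map f xs)

length-filter-cartesianProduct : {P : Pred (A × B) 0ℓ} (P? : Decidable P) (xs : List A) (ys : List B) →
  length (filter P? (cartesianProduct xs ys)) ≡ ∑ xs (λ x → length (filter (P? ∘ (x ,_)) ys))
length-filter-cartesianProduct P? []       ys = refl
length-filter-cartesianProduct P? (x ∷ xs) ys = trans
  (length-filter-++ P? (map (x ,_) ys) (cartesianProduct xs ys))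
  (cong₂ _+_ (length-filter-map P? (x ,_) ys) (length-filter-cartesianProduct P? xs ys))

∑-mono : (xs : List A) {f h : A → ℕ} → (∀ {x} → x ∈ xs → f x ≤ h x) → ∑ xs f ≤ ∑ xs h
∑-mono []       f≤h = z≤n
∑-mono (x ∷ xs) f≤h = +-mono-≤ (f≤h (here refl)) (∑-mono xs (f≤h ∘ there))

-- Subtraction is avoided by putting `h a` on the left: the term at `a` is traded for `b`. It serves
-- to treat the identity apart from all other self-maps.
∑-mono-except : {xs : List A} {a : A} {f h : A → ℕ} {b : ℕ} → Distinct xs → a ∈ xs →
  f a ≤ b → (∀ {x} → x ≢ a → f x ≤ h x) → ∑ xs f + h a ≤ b + ∑ xs h
∑-mono-except {xs = x ∷ xs} {f = f} {h} {b} (x∉ ∷ d) (here refl) fa≤b f≤h = begin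
  f x + ∑ xs f + h x      ≡⟨ +-assoc (f x) (∑ xs f) (h x) ⟩
  f x + (∑ xs f + h x)    ≤⟨ +-mono-≤ fa≤b
      (+-monoˡ-≤ (h x) (∑-mono xs λ y∈ → f≤h (All.lookup x∉ y∈ ∘ sym))) ⟩
  b + (∑ xs h + h x)      ≡⟨ cong (b +_) (+-comm (∑ xs h) (h x)) ⟩
  b + (h x + ∑ xs h)      ∎
  where open ≤-Reasoning
∑-mono-except {xs = x ∷ xs} {a} {f} {h} {b} (x∉ ∷ d) (there a∈) fa≤b f≤h = begin
  f x + ∑ xs f + h a      ≡⟨ +-assoc (f x) (∑ xs f) (h a) ⟩
  f x + (∑ xs f + h a)    ≤⟨ +-mono-≤ (f≤h (All.lookup x∉ a∈)) (∑-mono-except d a∈ fa≤b f≤h) ⟩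
  h x + (b + ∑ xs h)      ≡⟨ sym (+-assoc (h x) b (∑ xs h)) ⟩
  h x + b + ∑ xs h        ≡⟨ cong (_+ ∑ xs h) (+-comm (h x) b) ⟩
  b + h x + ∑ xs h        ≡⟨ +-assoc b (h x) (∑ xs h) ⟩
  b + (h x + ∑ xs h)      ∎
  where open ≤-Reasoning

∑-*ˡ : (c : ℕ) (xs : List A) (f : A → ℕ) → ∑ xs (λ x → c * f x) ≡ c * ∑ xs f
∑-*ˡ c []       f = sym (*-zeroʳ c)
∑-*ˡ c (x ∷ xs) f = trans (cong (c * f x +_) (∑-*ˡ c xs f)) (sym (*-distribˡ-+ c (f x) (∑ xs f)))

∑-*ʳ : (c : ℕ) (xs : List A) (f : A → ℕ) → ∑ xs (λ x → f x * c) ≡ ∑ xs f * c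
∑-*ʳ c []       f = refl
∑-*ʳ c (x ∷ xs) f = trans (cong (f x * c +_) (∑-*ʳ c xs f)) (sym (*-distribʳ-+ c (f x) (∑ xs f)))

∑-const : (xs : List A) (c : ℕ) → ∑ xs (λ _ → c) ≡ length xs * c
∑-const []       c = refl
∑-const (x ∷ xs) c = cong (c +_) (∑-const xs c)

∑-cong : (xs : List A) {f h : A → ℕ} → f ≗ h → ∑ xs f ≡ ∑ xs h
∑-cong xs f≗h = cong sum (map-cong f≗h xs)

∑-++ : (xs ys : List A) (f : A → ℕ) → ∑ (xs ++ ys) f ≡ ∑ xs f + ∑ ys f
∑-++ []       ys f = refl
∑-++ (x ∷ xs) ys f = trans (cong (f x +_) (∑-++ xs ys f)) (sym (+-assoc (f x) _ _))

∑-map : (g : A → B) (xs : List A) (f : B → ℕ) → ∑ (map g xs) f ≡ ∑ xs (f ∘ g)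
∑-map g xs f = cong sum (sym (map-∘ xs))

∑-cartesianProductWith : (g : A → B → C) (xs : List A) (ys : List B) (f : C → ℕ) →
  ∑ (cartesianProductWith g xs ys) f ≡ ∑ xs (λ x → ∑ ys (λ y → f (g x y)))
∑-cartesianProductWith g []       ys f = refl
∑-cartesianProductWith g (x ∷ xs) ys f = trans (∑-++ (map (g x) ys) _ f)
  (cong₂ _+_ (∑-map (g x) ys f) (∑-cartesianProductWith g xs ys f))

-- Vectors with entries from a finite list

vectors : List A → (n : ℕ) → List (Vec A n)
vectors xs zero    = [] ∷ []
vectors xs (suc n) = cartesianProductWith _∷_ xs (vectors xs n)

∈-vectors : {xs : List A} {n : ℕ} (v : Vec A n) → (∀ i → lookup v i ∈ xs) → v ∈ vectors xs n
∈-vectors []      p = here refl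
∈-vectors (x ∷ v) p = ∈-cartesianProductWith⁺ _∷_ (p zero) (∈-vectors v (p ∘ suc))

vectors-distinct : {xs : List A} → Distinct xs → ∀ n → Distinct (vectors xs n)
vectors-distinct d zero    = [] ∷ []
vectors-distinct d (suc n) =
  Distinct.cartesianProductWith⁺ _∷_ Vec.∷-injective d (vectors-distinct d n)

length-vectors : (xs : List A) (n : ℕ) → length (vectors xs n) ≡ length xs ^ n
length-vectors xs zero    = refl
length-vectors xs (suc n) = trans (length-cartesianProductWith _∷_ xs (vectors xs n))
  (cong (length xs *_) (length-vectors xs n))

-- By the distributive law the sum over all vectors of a product over the coordinates is the product
-- of the coordinatewise sums.
∑-vectors-product : (xs : List A) {c : ℕ} (n : ℕ) (h : Fin n → A → ℕ) → (∀ i → ∑ xs (h i) ≤ c) →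
  ∑ (vectors xs n) (λ v → product (tabulate λ i → h i (lookup v i))) ≤ c ^ n
∑-vectors-product xs zero h ≤c = ≤-refl
∑-vectors-product xs {c} (suc n) h ≤c = begin
  ∑ (vectors xs (suc n)) (λ v → product (tabulate λ i → h i (lookup v i)))
    ≡⟨ ∑-cartesianProductWith _∷_ xs (vectors xs n) _ ⟩
  ∑ xs (λ x → ∑ (vectors xs n) λ v → h zero x * rest v)
    ≡⟨ ∑-cong xs (λ x → ∑-*ˡ (h zero x) (vectors xs n) rest) ⟩
  ∑ xs (λ x → h zero x * ∑ (vectors xs n) rest)
    ≡⟨ ∑-*ʳ (∑ (vectors xs n) rest) xs (h zero) ⟩
  ∑ xs (h zero) * ∑ (vectors xs n) rest
    ≤⟨ *-mono-≤ (≤c zero) (∑-vectors-product xs n (h ∘ suc) (≤c ∘ suc)) ⟩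
  c * c ^ n ∎
  where
  open ≤-Reasoning
  rest : Vec _ n → ℕ
  rest v = product (tabulate λ i → h (suc i) (lookup v i))

lookup-injective : {n : ℕ} {v w : Vec A n} → lookup v ≗ lookup w → v ≡ w
lookup-injective {v = v} {w} eq =
  trans (sym (Vec.tabulate∘lookup v)) (trans (Vec.tabulate-cong eq) (Vec.tabulate∘lookup w))

-- Labelled graphs as bit vectors

bools : List Bool
bools = false ∷ true ∷ []

∈-bools : ∀ b → b ∈ bools
∈-bools false = here refl
∈-bools true  = there (here refl)

bools-distinct : Distinct bools
bools-distinct = ((λ ()) ∷ []) ∷ [] ∷ []

-- The binomial coefficient n(n-1)/2, the number of unordered pairs of vertices.
tri : ℕ → ℕ
tri zero    = 0
tri (suc n) = n + tri n

-- Numbers the unordered pairs of distinct vertices, those containing `zero` first; a diagonal pair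
-- has no number. `ends` lists the two members of a pair, the smaller one first.
pos : ∀ {n} → Fin n → Fin n → Maybe (Fin (tri n))
pos         zero    zero    = nothing
pos {suc n} zero    (suc y) = just (y ↑ˡ tri n)
pos {suc n} (suc x) zero    = just (x ↑ˡ tri n)
pos {suc n} (suc x) (suc y) = Maybe.map (n ↑ʳ_) (pos x y)

ends : ∀ n → Fin (tri n) → Fin n × Fin n
ends (suc n) i = [ (λ y → zero , suc y) , (λ j → Product.map suc suc (ends n j)) ]′ (splitAt n i)

pos-sym : ∀ {n} (x y : Fin n) → pos x y ≡ pos y x
pos-sym zero    zero    = refl
pos-sym zero    (suc y) = refl
pos-sym (suc x) zero    = refl
pos-sym (suc x) (suc y) = cong (Maybe.map _) (pos-sym x y)

pos-diagonal : ∀ {n} (x : Fin n) → pos x x ≡ nothing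
pos-diagonal zero    = refl
pos-diagonal (suc x) = cong (Maybe.map _) (pos-diagonal x)

pos-nothing : ∀ {n} (x y : Fin n) → pos x y ≡ nothing → x ≡ y
pos-nothing zero    zero    eq = refl
pos-nothing (suc x) (suc y) eq with pos x y in eq′
... | nothing = cong suc (pos-nothing x y eq′)

pos-ends : ∀ n (i : Fin (tri n)) → pos (proj₁ (ends n i)) (proj₂ (ends n i)) ≡ just i
pos-ends (suc n) i with splitAt n i in eq
... | inj₁ y = cong just (splitAt⁻¹-↑ˡ eq)
... | inj₂ j = trans (cong (Maybe.map (n ↑ʳ_)) (pos-ends n j)) (cong just (splitAt⁻¹-↑ʳ {n} eq))

SamePair : {A : Set} → A × A → A × A → Set
SamePair (a , b) (c , d) = (a ≡ c × b ≡ d) ⊎ (a ≡ d × b ≡ c)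

ends-pos : ∀ {n} (x y : Fin n) {i : Fin (tri n)} → pos x y ≡ just i → SamePair (ends n i) (x , y)
ends-pos {suc n} zero (suc y) refl rewrite splitAt-↑ˡ n y (tri n) = inj₁ (refl , refl)
ends-pos {suc n} (suc x) zero refl rewrite splitAt-↑ˡ n x (tri n) = inj₂ (refl , refl)
ends-pos {suc n} (suc x) (suc y) eq with pos x y in eq′
ends-pos {suc n} (suc x) (suc y) refl | just j rewrite splitAt-↑ʳ n (tri n) j
  with ends-pos x y eq′
... | inj₁ (p , q) = inj₁ (cong suc p , cong suc q)
... | inj₂ (p , q) = inj₂ (cong suc p , cong suc q)

samePair-joinʳ : {A : Set} {p q r : A × A} → SamePair r p → SamePair r q → SamePair p q
samePair-joinʳ (inj₁ (refl , refl)) (inj₁ (refl , refl)) = inj₁ (refl , refl)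
samePair-joinʳ (inj₁ (refl , refl)) (inj₂ (refl , refl)) = inj₂ (refl , refl)
samePair-joinʳ (inj₂ (refl , refl)) (inj₁ (refl , refl)) = inj₂ (refl , refl)
samePair-joinʳ (inj₂ (refl , refl)) (inj₂ (refl , refl)) = inj₁ (refl , refl)

pos-injective : ∀ {n} (x y x′ y′ : Fin n) {i : Fin (tri n)} →
  pos x y ≡ just i → pos x′ y′ ≡ just i → SamePair (x , y) (x′ , y′)
pos-injective x y x′ y′ eq eq′ = samePair-joinʳ (ends-pos x y eq) (ends-pos x′ y′ eq′)

¬T⇒≡false : ∀ {b} → ¬ T b → b ≡ false
¬T⇒≡false {false} _ = refl
¬T⇒≡false {true}  h = contradiction _ h

-- Codes make labelled graphs an explicit finite list on which propositional equality is the right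
-- notion, unlike records that contain functions and proofs.
Code : ℕ → Set
Code n = Vec Bool (tri n)

decode : ∀ n → Code n → Graph n
decode n v = record
  { adj       = λ x y → maybe′ (lookup v) false (pos x y)
  ; symmetric = λ x y → cong (maybe′ (lookup v) false) (pos-sym x y)
  ; loopless  = λ x → subst (λ m → ¬ T (maybe′ (lookup v) false m)) (sym (pos-diagonal x)) id
  }

encode : ∀ {n} → (Fin n → Fin n → Bool) → Code n
encode {n} a = Vec.tabulate (λ i → a (proj₁ (ends n i)) (proj₂ (ends n i)))

adj-loop : ∀ {n} (G : Graph n) x → adj G x x ≡ false
adj-loop G x = ¬T⇒≡false (loopless G x)

adj-decode-ends : ∀ n (v : Code n) i → adj (decode n v) (proj₁ (ends n i)) (proj₂ (ends n i)) ≡ lookup v i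
adj-decode-ends n v i = cong (maybe′ (lookup v) false) (pos-ends n i)

adj-decode-encode : ∀ {n} (a : Fin n → Fin n → Bool) → (∀ x y → a x y ≡ a y x) → (∀ x → a x x ≡ false) →
  ∀ x y → adj (decode n (encode a)) x y ≡ a x y
adj-decode-encode {n} a a-sym a-loop x y with pos x y in eq
... | nothing rewrite pos-nothing x y eq = sym (a-loop y)
... | just i = trans (Vec.lookup∘tabulate _ i) (unfold (ends-pos x y eq))
  where
  unfold : SamePair (ends n i) (x , y) → a (proj₁ (ends n i)) (proj₂ (ends n i)) ≡ a x y
  unfold (inj₁ (p , q)) = cong₂ a p q
  unfold (inj₂ (p , q)) = trans (cong₂ a p q) (a-sym y x)

decode-injective : ∀ n {v w : Code n} → (∀ x y → adj (decode n v) x y ≡ adj (decode n w) x y) → v ≡ w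
decode-injective n {v} {w} eq = lookup-injective λ i →
  trans (sym (adj-decode-ends n v i)) (trans (eq (proj₁ (ends n i)) (proj₂ (ends n i)))
      (adj-decode-ends n w i))

codes : ∀ n → List (Code n)
codes n = vectors bools (tri n)

∈-codes : ∀ n (v : Code n) → v ∈ codes n
∈-codes n v = ∈-vectors v (λ i → ∈-bools _)

codes-distinct : ∀ n → Distinct (codes n)
codes-distinct n = vectors-distinct bools-distinct (tri n)

length-codes : ∀ n → length (codes n) ≡ 2 ^ tri n
length-codes n = length-vectors bools (tri n)

-- Finite setoids

lookup-distinct : {A : Set} {_≈_ : A → A → Set} → (∀ {x y} → x ≈ y → y ≈ x) → {xs : List A} →
  AllPairs (λ x y → ¬ (x ≈ y)) xs → ∀ i j → List.lookup xs i ≈ List.lookup xs j → i ≡ j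
lookup-distinct ≈-sym (x∉ ∷ d) zero    zero    eq = refl
lookup-distinct ≈-sym {x ∷ xs} (x∉ ∷ d) zero    (suc j) eq = contradiction eq
    (All.lookup x∉ (∈-lookup {xs = xs} j))
lookup-distinct ≈-sym {x ∷ xs} (x∉ ∷ d) (suc i) zero    eq = contradiction (≈-sym eq)
    (All.lookup x∉ (∈-lookup {xs = xs} i))
lookup-distinct ≈-sym (x∉ ∷ d) (suc i) (suc j) eq = cong suc (lookup-distinct ≈-sym d i j eq)

-- Deduplication up to the equivalence leaves one representative of each class, and the positions in
-- the resulting list number the classes.
finite-setoid : (S : Setoid 0ℓ 0ℓ) → (∀ x y → Dec (Setoid._≈_ S x y)) → (xs : List (Setoid.Carrier S)) →
  (∀ y → Any (Setoid._≈_ S y) xs) → ∃ (HasCardinality S)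
finite-setoid S _≈?_ xs complete = length reps , record
  { to        = List.lookup reps
  ; cong      = λ { refl → S.refl }
  ; bijective = (λ {i} {j} → lookup-distinct S.sym (deduplicate-! DS xs) i j)
              , (λ y → let y∈ = SetoidMembership.∈-deduplicate⁺ S _≈?_
                             (λ z≈y x≈y → S.trans x≈y (S.sym z≈y)) (complete y)
                       in Any.index y∈ , λ { refl → S.sym (lookup-index y∈) })
  }
  where
  module S = Setoid S
  DS : DecSetoid 0ℓ 0ℓ
  DS = record { isDecEquivalence = record { isEquivalence = S.isEquivalence ; _≟_ = _≈?_ } }
  reps = deduplicate _≈?_ xs

-- Permutations and isomorphisms

maps : ∀ n → List (Vec (Fin n) n)
maps n = vectors (allFin n) n

∈-maps : ∀ {n} (v : Vec (Fin n) n) → v ∈ maps n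
∈-maps v = ∈-vectors v (λ i → ∈-allFin _)

maps-distinct : ∀ n → Distinct (maps n)
maps-distinct n = vectors-distinct (Distinct.allFin⁺ n) n

module _ {n : ℕ} where

  -- A permutation is stored together with its inverse. As the inverse is determined, each
  -- permutation still occurs once in `perms`.
  MutuallyInverse : Pred (Vec (Fin n) n × Vec (Fin n) n) 0ℓ
  MutuallyInverse (σ , τ) = (∀ x → lookup σ (lookup τ x) ≡ x) × (∀ x → lookup τ (lookup σ x) ≡ x)

  mutuallyInverse? : Decidable MutuallyInverse
  mutuallyInverse? (σ , τ) = all? (λ x → lookup σ (lookup τ x) ≟ x) ×-dec all?
      (λ x → lookup τ (lookup σ x) ≟ x)

perms : ∀ n → List (Vec (Fin n) n × Vec (Fin n) n)
perms n = filter mutuallyInverse? (cartesianProduct (maps n) (maps n))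

∈-perms : ∀ {n} {στ : Vec (Fin n) n × Vec (Fin n) n} → MutuallyInverse στ → στ ∈ perms n
∈-perms {στ = σ , τ} = ∈-filter⁺ mutuallyInverse? (∈-cartesianProduct⁺ (∈-maps σ) (∈-maps τ))

perms-inverse : ∀ {n} {στ : Vec (Fin n) n × Vec (Fin n) n} → στ ∈ perms n → MutuallyInverse στ
perms-inverse {n} στ∈ = proj₂ (∈-filter⁻ mutuallyInverse? {xs = cartesianProduct (maps n) (maps n)} στ∈)

perms-distinct : ∀ n → Distinct (perms n)
perms-distinct n = Distinct.filter⁺ mutuallyInverse?
    (Distinct.cartesianProduct⁺ (maps-distinct n) (maps-distinct n))

module _ {n : ℕ} where

  IsoVia : Graph n → Graph n → Vec (Fin n) n → Set
  IsoVia G H σ = ∀ x y → adj G x y ≡ adj H (lookup σ x) (lookup σ y)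

  isoVia? : ∀ G H σ → Dec (IsoVia G H σ)
  isoVia? G H σ = all? λ x → all? λ y → adj G x y Bool.≟ adj H (lookup σ x) (lookup σ y)

  isoVia⇒≅ : ∀ {G H στ} → στ ∈ perms n → IsoVia G H (proj₁ στ) → G ≅ H
  isoVia⇒≅ {στ = σ , τ} στ∈ iso =
    mk↔ₛ′ (lookup σ) (lookup τ) (proj₁ (perms-inverse στ∈)) (proj₂ (perms-inverse στ∈)) , iso

  ≅⇒isoVia : ∀ {G H : Graph n} → G ≅ H → ∃ λ στ → στ ∈ perms n × IsoVia G H (proj₁ στ)
  ≅⇒isoVia {G} {H} (φ , iso) = (Vec.tabulate φ.to , Vec.tabulate φ.from) , ∈-perms
    ( (λ x → trans (Vec.lookup∘tabulate φ.to _)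
        (trans (cong φ.to (Vec.lookup∘tabulate φ.from x)) (φ.strictlyInverseˡ x)))
    , (λ x → trans (Vec.lookup∘tabulate φ.from _)
        (trans (cong φ.from (Vec.lookup∘tabulate φ.to x)) (φ.strictlyInverseʳ x))))
    , λ x y → trans (iso x y) (sym (cong₂ (adj H) (Vec.lookup∘tabulate φ.to x)
        (Vec.lookup∘tabulate φ.to y)))
    where module φ = Inverse φ

  search : ∀ G H → Dec (Any (λ στ → IsoVia G H (proj₁ στ)) (perms n))
  search G H = Any.any? (λ στ → isoVia? G H (proj₁ στ)) (perms n)

  abstract
    -- Abstract, so that the search through all permutations is not unfolded in type checking.
    _≅?_ : (G H : Graph n) → Dec (G ≅ H)
    G ≅? H = map′
      (λ a → let στ , στ∈ , iso = find a in isoVia⇒≅ {G} {H} {στ} στ∈ iso)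
      (λ G≅H → let στ , στ∈ , iso = ≅⇒isoVia {G} {H} G≅H in lose στ∈ iso)
      (search G H)

≗⇒≅ : ∀ {n} {G H : Graph n} → (∀ x y → adj G x y ≡ adj H x y) → G ≅ H
≗⇒≅ eq = mk↔ₛ′ id id (λ _ → refl) (λ _ → refl) , eq

decode-encode-≅ : ∀ {n} (G : Graph n) → decode n (encode (adj G)) ≅ G
decode-encode-≅ {n} G = ≗⇒≅ {G = decode n (encode (adj G))} {G}
    (adj-decode-encode (adj G) (symmetric G) (adj-loop G))

codes-complete : ∀ {n} (G : Graph n) → Any (λ v → decode n v ≅ G) (codes n)
codes-complete {n} G = lose (∈-codes n (encode (adj G))) (decode-encode-≅ G)

𝒢-finite : ∀ n → ∃ (HasCardinality (𝒢 n))
𝒢-finite n = finite-setoid (𝒢 n) _≅?_ (List.map (decode n) (codes n))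
  (λ G → map⁺ (Any.map (λ {v} → ≅-sym {G = decode n v} {G}) (codes-complete G)))

-- A labelled graph can be recovered from its class and an isomorphism to the representative of that
-- class. The factor `length (perms n)` later cancels against the one in `burnside-≤`.
codes≤classes*perms : ∀ n {g} → HasCardinality (𝒢 n) g → 2 ^ tri n ≤ g * length (perms n)
codes≤classes*perms n {g} card = begin
  2 ^ tri n
    ≡⟨ sym (length-codes n) ⟩
  length (codes n)
    ≤⟨ length-≤-injection (codes n) (cartesianProduct (allFin g) (perms n)) f (codes-distinct n)
         (λ {v} _ → ∈-cartesianProduct⁺ (∈-allFin (cls v)) (proj₁ (proj₂ (via v))))
         (λ {v} {w} _ _ → inj v w) ⟩
  length (cartesianProduct (allFin g) (perms n))
    ≡⟨ length-cartesianProduct (allFin g) (perms n) ⟩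
  length (allFin g) * length (perms n)
    ≡⟨ cong (_* length (perms n)) (length-tabulate {n = g} id) ⟩
  g * length (perms n) ∎
  where
  open ≤-Reasoning
  module R = Bijection card
  cls : Code n → Fin g
  cls v = proj₁ (R.surjective (decode n v))
  via : ∀ v → ∃ λ στ → στ ∈ perms n × IsoVia (decode n v) (R.to (cls v)) (proj₁ στ)
  via v = ≅⇒isoVia {G = decode n v} {R.to (cls v)}
      (≅-sym {G = R.to (cls v)} {decode n v} (proj₂ (R.surjective (decode n v)) refl))
  f : Code n → Fin g × (Vec (Fin n) n × Vec (Fin n) n)
  f v = cls v , proj₁ (via v)
  inj : ∀ v w → f v ≡ f w → v ≡ w
  inj v w eq = decode-injective n λ x y →
    trans (proj₂ (proj₂ (via v)) x y)
    (trans (cong (λ { (i , (σ , _)) → adj (R.to i) (lookup σ x) (lookup σ y) }) eq)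
     (sym (proj₂ (proj₂ (via w)) x y)))

-- Burnside's inequality

module _ {n : ℕ} where

  -- On a finite vertex set injectivity amounts to bijectivity, so a single vector suffices here and
  -- no inverse has to be carried along.
  Automorphic : Vec (Fin n) n → Graph n → Set
  Automorphic α G = (∀ x y → lookup α x ≡ lookup α y → x ≡ y) × IsoVia G G α

-- For pairwise non-isomorphic graphs `R i`, a pair (i, σ) is sent to the labelled graph v obtained
-- by pulling `R i` back along σ, together with an automorphism of v. Injectivity of this map bounds
-- u times the number of permutations by the number of pairs (automorphism, labelled graph)
-- satisfying `P`.
module BurnsideInequality (n : ℕ) {u : ℕ} (R : Fin u → Graph n) (R-inj : ∀ {i j} → R i ≅ R j → i ≡ j)
  {P : Pred (Vec (Fin n) n × Code n) 0ℓ} (P? : Decidable P)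
  (R-P : ∀ i α v → R i ≅ decode n v → Automorphic α (decode n v) → P (α , v)) where

  pullback : Graph n → Vec (Fin n) n → Code n
  pullback G σ = encode (λ x y → adj G (lookup σ x) (lookup σ y))

  pullback-iso : ∀ G σ → IsoVia (decode n (pullback G σ)) G σ
  pullback-iso G σ = adj-decode-encode _ (λ x y → symmetric G _ _) (λ x → adj-loop G _)

  -- An isomorphism from v to R i depending only on i and v, so that σ ↦ base⁻¹ ∘ σ is injective
  -- on the permutations σ with the same pullback v, and has automorphisms of v as values.
  base : Fin u → Code n → Vec (Fin n) n × Vec (Fin n) n
  base i v with search (decode n v) (R i)
  ... | yes a = proj₁ (find a)
  ... | no  _ = Vec.allFin n , Vec.allFin n

  base-iso : ∀ i v → R i ≅ decode n v →
    base i v ∈ perms n × IsoVia (decode n v) (R i) (proj₁ (base i v))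
  base-iso i v Ri≅v with search (decode n v) (R i)
  ... | yes a = proj₂ (find a)
  ... | no ¬a = contradiction
    (let στ , στ∈ , iso = ≅⇒isoVia {G = decode n v} {R i} (≅-sym {G = R i} {decode n v} Ri≅v) in lose
        στ∈ iso) ¬a

  Ix = Fin u × (Vec (Fin n) n × Vec (Fin n) n)

  graphOf : Ix → Code n
  graphOf (i , (σ , τ)) = pullback (R i) σ

  factor : Ix → Vec (Fin n) n × Code n
  factor p@(i , (σ , τ)) = Vec.map (lookup (proj₂ (base i (graphOf p)))) σ , graphOf p

  graphOf-≅ : ∀ i {στ} → στ ∈ perms n → R i ≅ decode n (graphOf (i , στ))
  graphOf-≅ i {στ} στ∈ = ≅-sym {G = decode n (graphOf (i , στ))} {R i}
      (isoVia⇒≅ {G = decode n (graphOf (i , στ))} {R i} {στ} στ∈ (pullback-iso (R i) (proj₁ στ)))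

  -- Both σ and the base isomorphism t map v isomorphically to `R i`, so t⁻¹ ∘ σ is an automorphism
  -- of v.
  factor-automorphic : ∀ i {στ} → στ ∈ perms n →
    Automorphic (proj₁ (factor (i , στ))) (decode n (graphOf (i , στ)))
  factor-automorphic i {στ@(σ , τ)} στ∈ = inj , λ x y → begin
    adj G x y                                                       ≡⟨ pullback-iso (R i) σ x y ⟩
    adj (R i) (lookup σ x) (lookup σ y)                     ≡⟨ sym (cong₂ (adj (R i)) (tα x) (tα y)) ⟩
    adj (R i) (lookup t (lookup α x)) (lookup t (lookup α y)) ≡⟨ sym (t-iso (lookup α x) (lookup α y)) ⟩
    adj G (lookup α x) (lookup α y)                         ∎
    where
    open ≡-Reasoning
    v = graphOf (i , στ)
    G = decode n v
    α = proj₁ (factor (i , στ))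
    t = proj₁ (base i v)
    t⁻¹ = proj₂ (base i v)
    t-perm = perms-inverse (proj₁ (base-iso i v (graphOf-≅ i στ∈)))
    t-iso = proj₂ (base-iso i v (graphOf-≅ i στ∈))
    tα : ∀ x → lookup t (lookup α x) ≡ lookup σ x
    tα x = trans (cong (lookup t) (Vec.lookup-map x (lookup t⁻¹) σ)) (proj₁ t-perm (lookup σ x))
    inj : ∀ x y → lookup α x ≡ lookup α y → x ≡ y
    inj x y eq = trans (sym (proj₂ (perms-inverse στ∈) x))
        (trans (cong (lookup τ) (trans (sym (tα x)) (trans (cong (lookup t) eq) (tα y))))
        (proj₂ (perms-inverse στ∈) y))

  -- Equal pullbacks make `R i` and `R j` isomorphic, so i = j. The base isomorphism depends only on
  -- i and the pullback, hence is the same for both and can be cancelled.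
  factor-injective : ∀ i j {στ στ′} → στ ∈ perms n → στ′ ∈ perms n →
    factor (i , στ) ≡ factor (j , στ′) → (i , στ) ≡ (j , στ′)
  factor-injective i j {στ@(σ , τ)} {στ′@(σ′ , τ′)} στ∈ στ′∈ eq with R-inj {i} {j}
    (≅-trans {G = R i} {decode n (graphOf (i , στ))} {R j} (graphOf-≅ i στ∈)
      (subst (λ v → decode n v ≅ R j) (sym (cong proj₂ eq))
          (≅-sym {G = R j} {decode n (graphOf (j , στ′))} (graphOf-≅ j στ′∈))))
  ... | refl = cong (i ,_) (cong₂ _,_ σ≡σ′ τ≡τ′)
    where
    v = graphOf (i , στ)
    t = proj₁ (base i v)
    t⁻¹ = proj₂ (base i v)
    t-perm = perms-inverse (proj₁ (base-iso i v (graphOf-≅ i στ∈)))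
    αs : Vec.map (lookup t⁻¹) σ ≡ Vec.map (lookup t⁻¹) σ′
    αs = trans (cong proj₁ eq) (cong (λ w → Vec.map (lookup (proj₂ (base i w))) σ′) (sym (cong proj₂ eq)))
    t⁻¹-eq : ∀ x → lookup t⁻¹ (lookup σ x) ≡ lookup t⁻¹ (lookup σ′ x)
    t⁻¹-eq x = trans (sym (Vec.lookup-map x _ σ))
        (trans (cong (λ w → lookup w x) αs) (Vec.lookup-map x _ σ′))
    σ-eq : ∀ x → lookup σ x ≡ lookup σ′ x
    σ-eq x = trans (sym (proj₁ t-perm _)) (trans (cong (lookup t) (t⁻¹-eq x)) (proj₁ t-perm _))
    σ≡σ′ : σ ≡ σ′
    σ≡σ′ = lookup-injective σ-eq
    τ≡τ′ : τ ≡ τ′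
    τ≡τ′ = lookup-injective λ x → begin
      lookup τ x                         ≡⟨ cong (lookup τ) (sym (proj₁ (perms-inverse στ′∈) x)) ⟩
      lookup τ (lookup σ′ (lookup τ′ x)) ≡⟨ cong (lookup τ) (sym (σ-eq _)) ⟩
      lookup τ (lookup σ (lookup τ′ x))  ≡⟨ proj₂ (perms-inverse στ∈) _ ⟩
      lookup τ′ x                        ∎
      where open ≡-Reasoning

  burnside-≤ : u * length (perms n) ≤ length (filter P? (cartesianProduct (maps n) (codes n)))
  burnside-≤ = begin
    u * length (perms n)
      ≡⟨ cong (_* length (perms n)) (sym (length-tabulate {n = u} id)) ⟩
    length (allFin u) * length (perms n)
      ≡⟨ sym (length-cartesianProduct (allFin u) (perms n)) ⟩
    length (cartesianProduct (allFin u) (perms n))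
      ≤⟨ length-≤-injection (cartesianProduct (allFin u) (perms n)) _ factor
          (Distinct.cartesianProduct⁺ (Distinct.allFin⁺ u) (perms-distinct n)) into
          (λ {p} {q} p∈ q∈ → factor-injective (proj₁ p) (proj₁ q) (perm∈ p∈) (perm∈ q∈)) ⟩
    length (filter P? (cartesianProduct (maps n) (codes n))) ∎
    where
    open ≤-Reasoning
    perm∈ : ∀ {p} → p ∈ cartesianProduct (allFin u) (perms n) → proj₂ p ∈ perms n
    perm∈ p∈ = proj₂ (∈-cartesianProduct⁻ (allFin u) (perms n) p∈)
    into : ∀ {p} → p ∈ cartesianProduct (allFin u) (perms n) → factor p ∈ filter P?
        (cartesianProduct (maps n) (codes n))
    into {p@(i , στ)} p∈ = ∈-filter⁺ P? (∈-cartesianProduct⁺ (∈-maps _) (∈-codes n _))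
      (R-P i _ _ (graphOf-≅ i (perm∈ p∈)) (factor-automorphic i (perm∈ p∈)))

-- Harmonious colourings

module _ {n : ℕ} {G H : Graph n} {k l : ℕ} {f : Fin n → Fin k} {g : Fin n → Fin l}
  (H⊆G : ∀ {x y} → Adj H x y → Adj G x y) (g-refines-f : ∀ {x y} → g x ≡ g y → f x ≡ f y) where

  -- Two edges that violate the condition for `g` on `H` would violate it for `f` on `G`. This
  -- covers passing to a subgraph, injective recolouring, and pointwise equal colourings or
  -- adjacencies.
  harmonious-refine : Harmonious G f → Harmonious H g
  harmonious-refine (proper , one) = proper′ , one′
    where
    proper′ : Proper H g
    proper′ x y xy eq = proper x y (H⊆G xy) (g-refines-f eq)
    -- The edge uv has differently coloured ends, so i and j are exactly the `g`-colours of u and v;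
    -- any vertex coloured i or j then shares its `f`-colour with u or v.
    among : ∀ {i j u v} → InducedEdge H g i j u v → ∀ {x} → g x ≡ i ⊎ g x ≡ j → f x ≡ f u ⊎ f x ≡ f v
    among {u = u} {v} (inj₁ refl , inj₁ eq , uv) = contradiction (sym eq) (proper′ u v uv)
    among (inj₁ refl , inj₂ refl , uv) = Sum.map g-refines-f g-refines-f
    among (inj₂ refl , inj₁ refl , uv) = Sum.swap ∘ Sum.map g-refines-f g-refines-f
    among {u = u} {v} (inj₂ refl , inj₂ eq , uv) = contradiction (sym eq) (proper′ u v uv)
    one′ : ∀ i j → AtMostOneEdge H g i j
    one′ i j u v x y e@(_ , _ , uv) (gx , gy , xy) = one (f u) (f v) u v x y
      (inj₁ refl , inj₂ refl , H⊆G uv) (among e gx , among e gy , H⊆G xy)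

Adj-irreflexive : ∀ {n} (G : Graph n) {x y} → Adj G x y → x ≢ y
Adj-irreflexive G xy refl = loopless G _ xy

-- An injective colouring refines the identity colouring, in which two classes are two single
-- vertices and span at most one edge.
injective⇒harmonious : ∀ {n k} (G : Graph n) {f : Fin n → Fin k} → (∀ {x y} → f x ≡ f y → x ≡ y) →
    Harmonious G f
injective⇒harmonious {n} G {f} inj = harmonious-refine {G = G} {G} {f = id} {f} id inj (proper , one)
  where
  proper : Proper G {n} id
  proper x y = Adj-irreflexive G
  one : ∀ i j → AtMostOneEdge G {n} id i j
  one i j u v x y (inj₁ refl , inj₁ refl , uv) _ = contradiction refl (Adj-irreflexive G uv)
  one i j u v x y (inj₂ refl , inj₂ refl , uv) _ = contradiction refl (Adj-irreflexive G uv)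
  one i j u v x y _ (inj₁ refl , inj₁ refl , xy) = contradiction refl (Adj-irreflexive G xy)
  one i j u v x y _ (inj₂ refl , inj₂ refl , xy) = contradiction refl (Adj-irreflexive G xy)
  one i j u v x y (inj₁ refl , inj₂ refl , _) (inj₁ refl , inj₂ refl , _) = inj₁ (refl , refl)
  one i j u v x y (inj₁ refl , inj₂ refl , _) (inj₂ refl , inj₁ refl , _) = inj₂ (refl , refl)
  one i j u v x y (inj₂ refl , inj₁ refl , _) (inj₁ refl , inj₂ refl , _) = inj₂ (refl , refl)
  one i j u v x y (inj₂ refl , inj₁ refl , _) (inj₂ refl , inj₁ refl , _) = inj₁ (refl , refl)

Close : ∀ {n} → Graph n → Fin n → Fin n → Set
Close G x y = x ≡ y ⊎ Adj G x y ⊎ ∃ λ w → Adj G x w × Adj G y w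

Diameter≤2 : ∀ {n} → Graph n → Set
Diameter≤2 G = ∀ x y → Close G x y

-- Two distinct vertices of one colour cannot be adjacent, and a common neighbour w would give two
-- edges between their colour class and that of w.
harmonious⇒injective : ∀ {n k} (G : Graph n) {f : Fin n → Fin k} → Diameter≤2 G → Harmonious G f →
  ∀ {x y} → f x ≡ f y → x ≡ y
harmonious⇒injective G {f} diam (proper , one) {x} {y} eq with diam x y
... | inj₁ x≡y = x≡y
... | inj₂ (inj₁ xy) = contradiction eq (proper x y xy)
... | inj₂ (inj₂ (w , xw , yw))
  with one (f x) (f w) x w y w (inj₁ refl , inj₂ refl , xw) (inj₁ (sym eq) , inj₂ refl , yw)
... | inj₁ (x≡y , _) = x≡y
... | inj₂ (x≡w , _) = contradiction x≡w (Adj-irreflexive G xw)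

χ-harm-cong : ∀ {n} (G H : Graph n) →
  (∀ {k} (f : Fin n → Fin k) → Harmonious G f → Harmonious H f) →
  (∀ {k} (f : Fin n → Fin k) → Harmonious H f → Harmonious G f) → χ-harm G ≗ χ-harm H
χ-harm-cong {n} G H G⇒H H⇒G k =
  count-cong (harmonious? G ∘ finToFun {k} {n}) (harmonious? H ∘ finToFun {k} {n})
      (Distinct.allFin⁺ (k ^ n))
    (λ {c} → G⇒H (finToFun {k} {n} c)) (λ {c} → H⇒G (finToFun {k} {n} c))

χ-harm-diameter≤2 : ∀ {n} (G H : Graph n) → Diameter≤2 G → Diameter≤2 H → χ-harm G ≗ χ-harm H
χ-harm-diameter≤2 G H dG dH = χ-harm-cong G H
  (λ f h → injective⇒harmonious H (harmonious⇒injective G dG h))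
  (λ f h → injective⇒harmonious G (harmonious⇒injective H dH h))

χ-harm-≗ : ∀ {n} (G H : Graph n) → (∀ x y → adj G x y ≡ adj H x y) → χ-harm G ≗ χ-harm H
χ-harm-≗ G H eq = χ-harm-cong G H
  (λ f → harmonious-refine {G = G} {H} (λ {x} {y} → subst T (sym (eq x y))) id)
  (λ f → harmonious-refine {G = H} {G} (λ {x} {y} → subst T (eq x y)) id)

-- Differences of the harmonious polynomial

finToFun-injective : ∀ {k} n {c d : Fin (k ^ n)} → finToFun {k} {n} c ≗ finToFun d → c ≡ d
finToFun-injective {k} n {c} {d} eq = trans (sym (funToFin-finToFin {n} {k} c))
  (trans (funToFin-cong n eq) (funToFin-finToFin {n} {k} d))
  where
  funToFin-cong : ∀ m {f g : Fin m → Fin k} → f ≗ g → funToFin f ≡ funToFin g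
  funToFin-cong zero    eq = refl
  funToFin-cong (suc m) eq = cong₂ Fin.combine (eq zero) (funToFin-cong m (eq ∘ suc))

punchIn-< : ∀ {n} (i : Fin (suc n)) (c : Fin n) → toℕ (punchIn i c) < toℕ i → toℕ c < toℕ i
punchIn-< (suc i) zero    p       = s≤s z≤n
punchIn-< (suc i) (suc c) (s≤s p) = s≤s (punchIn-< i c p)

module _ {n : ℕ} (G : Graph n) where

  UsesFirst : ∀ {K} → ℕ → Vec (Fin K) n → Set
  UsesFirst {K} j v = ∀ (c : Fin K) → toℕ c < j → ∃ λ x → lookup v x ≡ c

  Onto : ∀ K → ℕ → Pred (Vec (Fin K) n) 0ℓ
  Onto K j v = Harmonious G (lookup v) × UsesFirst j v

  onto? : ∀ K j → Decidable (Onto K j)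
  onto? K j v = harmonious? G (lookup v) ×-dec
    all? λ c → (toℕ c <? j) →-dec Fin.any? λ x → lookup v x ≟ c

  colourings : ∀ K → List (Vec (Fin K) n)
  colourings K = vectors (allFin K) n

  colourings-distinct : ∀ K → Distinct (colourings K)
  colourings-distinct K = vectors-distinct (Distinct.allFin⁺ K) n

  ∈-colourings : ∀ {K} (v : Vec (Fin K) n) → v ∈ colourings K
  ∈-colourings v = ∈-vectors v (λ _ → ∈-allFin _)

  -- δ j K is the j-th finite difference of the harmonious polynomial at K ∸ j.
  δ : ℕ → ℕ → ℕ
  δ j K = length (filter (onto? K j) (colourings K))

  harmonious-≗ : ∀ {k} {f g : Fin n → Fin k} → f ≗ g → Harmonious G f → Harmonious G g
  harmonious-≗ {f = f} {g} eq = harmonious-refine {G = G} {G} {f = f} {g} id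
    (λ {x} {y} gx≡gy → trans (eq x) (trans gx≡gy (sym (eq y))))

  δ-zero : ∀ K → δ 0 K ≡ χ-harm G K
  δ-zero K = count-≡-bijection (onto? K 0) (harmonious? G ∘ finToFun {K} {n}) (colourings-distinct K)
      (Distinct.allFin⁺ (K ^ n))
    (λ c → Vec.tabulate (finToFun {K} {n} c))
    (λ {c} {d} eq → finToFun-injective n λ x → trans (sym (Vec.lookup∘tabulate (finToFun {K} {n} c) x))
      (trans (cong (λ v → lookup v x) eq) (Vec.lookup∘tabulate (finToFun {K} {n} d) x)))
    (λ {c} h → ∈-colourings _ , harmonious-≗ (λ x → sym (Vec.lookup∘tabulate (finToFun {K} {n} c) x))
        h , λ _ ())
    (λ {v} h → let fv = finToFun-funToFin (lookup v) in
      funToFin (lookup v) , (∈-allFin _ , harmonious-≗ (λ x → sym (fv x)) (proj₁ h)) ,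
      trans (Vec.tabulate-cong fv) (Vec.tabulate∘lookup v))

  -- Pascal's recursion: the colourings are split by whether colour j, counted from zero, occurs. If
  -- it does not, deleting it from the palette leaves a colouring with `K` colours in which the
  -- first j keep their numbers.
  δ-suc : ∀ {j K} → j ≤ K → δ j (suc K) ≡ δ (suc j) (suc K) + δ j K
  δ-suc {j} {K} j≤K = trans (count-split (onto? (suc K) j) used? (colourings (suc K)))
      (cong₂ _+_ used unused)
    where
    c₀ : Fin (suc K)
    c₀ = fromℕ< (s≤s j≤K)
    c₀≡j : toℕ c₀ ≡ j
    c₀≡j = toℕ-fromℕ< (s≤s j≤K)
    Used : Pred (Vec (Fin (suc K)) n) 0ℓ
    Used v = ∃ λ x → lookup v x ≡ c₀
    used? : Decidable Used
    used? v = Fin.any? λ x → lookup v x ≟ c₀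
    used : length (filter (λ v → onto? (suc K) j v ×-dec used? v) (colourings (suc K))) ≡ δ (suc j) (suc K)
    used = count-cong _ (onto? (suc K) (suc j)) (colourings-distinct (suc K))
      (λ { ((h , u) , (x , vx)) → h , λ c →
          λ { (s≤s c≤j) → [ u c , (λ c≡j → x , trans vx (toℕ-injective (trans c₀≡j (sym c≡j)))) ]′
          (m≤n⇒m<n∨m≡n c≤j) } })
      (λ { (h , u) → (h , λ c c<j → u c (m<n⇒m<1+n c<j)) , u c₀ (s≤s (≤-reflexive c₀≡j)) })
    unused : length (filter (λ v → onto? (suc K) j v ×-dec ¬? (used? v)) (colourings (suc K))) ≡ δ j K
    unused = count-≡-bijection _ (onto? K j) (colourings-distinct (suc K)) (colourings-distinct K)
      (Vec.map (punchIn c₀))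
      (λ {v} {w} eq → lookup-injective λ x → punchIn-injective c₀ _ _
        (trans (sym (Vec.lookup-map x (punchIn c₀) v))
            (trans (cong (λ z → lookup z x) eq) (Vec.lookup-map x (punchIn c₀) w))))
      (λ {w} h → ∈-colourings _ , into w h)
      (λ {v} h → cover v h)
      where
      into : ∀ w → Onto K j w → Onto (suc K) j (Vec.map (punchIn c₀) w) × ¬ Used (Vec.map (punchIn c₀) w)
      into w (h , u) =
        ( harmonious-refine {G = G} {G} {f = lookup w} id
            (λ {x} {y} eq → punchIn-injective c₀ _ _ (trans (sym (lk x)) (trans eq (lk y)))) h
        , λ c c<j → let c₀≢c = λ eq → <⇒≢ c<j (trans (sym (cong toℕ eq)) c₀≡j)
                        pc = punchIn-punchOut c₀≢c
                        x , wx = u (punchOut c₀≢c) (subst (toℕ (punchOut c₀≢c) <_) c₀≡j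
                                   (punchIn-< c₀ (punchOut c₀≢c)
                                       (subst (λ z → toℕ z < toℕ c₀) (sym pc)
                                       (subst (toℕ c <_) (sym c₀≡j) c<j))))
                    in x , trans (lk x) (trans (cong (punchIn c₀) wx) pc))
        , λ { (x , eq) → punchInᵢ≢i c₀ (lookup w x) (trans (sym (lk x)) eq) }
        where
        lk : ∀ x → lookup (Vec.map (punchIn c₀) w) x ≡ punchIn c₀ (lookup w x)
        lk x = Vec.lookup-map x (punchIn c₀) w
      cover : ∀ v → Onto (suc K) j v × ¬ Used v → ∃ λ w → (w ∈ colourings K × Onto K j w) × Vec.map
          (punchIn c₀) w ≡ v
      cover v ((h , u) , ¬used) = w , (∈-colourings w ,
        harmonious-refine {G = G} {G} {f = lookup v} id
            (λ {x} {y} eq → trans (sym (lk x)) (trans (cong (punchIn c₀) eq) (lk y))) h ,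
        λ c c<j → let x , vx = u (punchIn c₀ c)
                        (subst (_< j) (sym (toℕ-punchIn c (subst (toℕ c <_) (sym c₀≡j) c<j))) c<j)
                  in x , punchIn-injective c₀ _ _ (trans (lk x) vx)) ,
        lookup-injective λ x → trans (Vec.lookup-map x (punchIn c₀) w) (lk x)
        where
        c₀≢ : ∀ x → c₀ ≢ lookup v x
        c₀≢ x eq = ¬used (x , sym eq)
        w = Vec.tabulate λ x → punchOut (c₀≢ x)
        lk : ∀ x → punchIn c₀ (lookup w x) ≡ lookup v x
        lk x = trans (cong (punchIn c₀) (Vec.lookup∘tabulate (λ x → punchOut (c₀≢ x)) x))
            (punchIn-punchOut (c₀≢ x))
        toℕ-punchIn : ∀ {m} {i : Fin (suc m)} (c : Fin m) → toℕ c < toℕ i → toℕ (punchIn i c) ≡ toℕ c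
        toℕ-punchIn {i = suc i} zero    p       = refl
        toℕ-punchIn {i = suc i} (suc c) (s≤s p) = cong suc (toℕ-punchIn c p)

  -- Pigeonhole: j prescribed colours need j different vertices.
  δ-vanishes : ∀ {j K} → n < j → j ≤ K → δ j K ≡ 0
  δ-vanishes {j} {K} n<j j≤K = cong length (filter-none (onto? K j) (All.universal none (colourings K)))
    where
    none : ∀ v → ¬ Onto K j v
    none v (_ , u) = <⇒≱ n<j (injective⇒≤ {f = λ c → proj₁ (preimage c)} λ {c} {d} eq →
      inject≤-injective j≤K j≤K c d (trans (sym (proj₂ (preimage c)))
          (trans (cong (lookup v) eq) (proj₂ (preimage d)))))
      where
      preimage : ∀ (c : Fin j) → ∃ λ x → lookup v x ≡ inject≤ c j≤K
      preimage c = u (inject≤ c j≤K) (subst (_< j) (sym (toℕ-inject≤ c j≤K)) (toℕ<n c))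

  -- The identity colouring is counted. With `δ-vanishes`, n is therefore the largest j with `δ j j`
  -- nonzero, so the polynomial determines the number of vertices.
  δ-top : δ n n ≢ 0
  δ-top eq = <⇒≱ (subst (1 ≤_) eq
    (length-≤-injection (Vec.allFin n ∷ []) (filter (onto? n n) (colourings n)) id ([] ∷ [])
      (λ { (here refl) → ∈-filter⁺ (onto? n n) (∈-colourings (Vec.allFin n))
        ( injective⇒harmonious G (λ {x} {y} p → trans (sym (Vec.lookup-allFin x))
            (trans p (Vec.lookup-allFin y)))
        , λ c _ → c , Vec.lookup-allFin c) })
      (λ _ _ eq → eq))) z≤n

module _ {n m : ℕ} (G : Graph n) (H : Graph m) where

  -- The recursion of `δ-suc`, solved for the higher difference, expresses every difference by
  -- values of the polynomial at arguments up to `K`.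
  δ-cong : ∀ B → (∀ k → k ≤ B → χ-harm G k ≡ χ-harm H k) →
    ∀ j {K} → j ≤ K → K ≤ B → δ G j K ≡ δ H j K
  δ-cong B agree zero    {K} _ K≤B = trans (δ-zero G K) (trans (agree K K≤B) (sym (δ-zero H K)))
  δ-cong B agree (suc j) {suc K} (s≤s j≤K) K≤B = +-cancelʳ-≡ (δ H j K) _ _ (begin
    δ G (suc j) (suc K) + δ H j K ≡⟨ cong (δ G (suc j) (suc K) +_)
        (sym (δ-cong B agree j j≤K (≤-trans (n≤1+n K) K≤B))) ⟩
    δ G (suc j) (suc K) + δ G j K ≡⟨ sym (δ-suc G j≤K) ⟩
    δ G j (suc K)                 ≡⟨ δ-cong B agree j (m≤n⇒m≤1+n j≤K) K≤B ⟩
    δ H j (suc K)                 ≡⟨ δ-suc H j≤K ⟩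
    δ H (suc j) (suc K) + δ H j K ∎)
    where open ≡-Reasoning

  χ-harm-≗⇒≮ : χ-harm G ≗ χ-harm H → ¬ n < m
  χ-harm-≗⇒≮ eq n<m = δ-top H
    (trans (sym (δ-cong m (λ k _ → eq k) m ≤-refl ≤-refl)) (δ-vanishes G n<m ≤-refl))

χ-harm-order : ∀ {n m} (G : Graph n) (H : Graph m) → χ-harm G ≗ χ-harm H → n ≡ m
χ-harm-order G H eq = ≤-antisym (≮⇒≥ (χ-harm-≗⇒≮ H G (λ k → sym (eq k)))) (≮⇒≥ (χ-harm-≗⇒≮ G H eq))

-- Newton interpolation: an array obeying Pascal's recursion is determined by its diagonal, by
-- induction on the distance d from it.
pascal-diagonal : (a b : ℕ → ℕ → ℕ) →
  (∀ {j K} → j ≤ K → a j (suc K) ≡ a (suc j) (suc K) + a j K) →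
  (∀ {j K} → j ≤ K → b j (suc K) ≡ b (suc j) (suc K) + b j K) →
  (∀ j → a j j ≡ b j j) → ∀ d j → a j (j + d) ≡ b j (j + d)
pascal-diagonal a b a-suc b-suc diagonal zero    j rewrite +-identityʳ j = diagonal j
pascal-diagonal a b a-suc b-suc diagonal (suc d) j rewrite +-suc j d = begin
  a j (suc (j + d))                         ≡⟨ a-suc (m≤m+n j d) ⟩
  a (suc j) (suc j + d) + a j (j + d)       ≡⟨ cong₂ _+_ (ih (suc j)) (ih j) ⟩
  b (suc j) (suc j + d) + b j (j + d)       ≡⟨ sym (b-suc (m≤m+n j d)) ⟩
  b j (suc (j + d))                         ∎
  where
  open ≡-Reasoning
  ih = pascal-diagonal a b a-suc b-suc diagonal d

-- The diagonal differences up to n come from the values up to n, and the later ones vanish;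
-- together they determine all values.
χ-harm-determined : ∀ {n} (G H : Graph n) → (∀ k → k ≤ n → χ-harm G k ≡ χ-harm H k) → χ-harm G ≗ χ-harm H
χ-harm-determined {n} G H agree K = trans (sym (δ-zero G K))
    (trans (pascal-diagonal (δ G) (δ H) (δ-suc G) (δ-suc H) diagonal K 0) (δ-zero H K))
  where
  diagonal : ∀ j → δ G j j ≡ δ H j j
  diagonal j = [ (λ j≤n → δ-cong G H n agree j ≤-refl j≤n)
               , (λ n<j → trans (δ-vanishes G n<j ≤-refl) (sym (δ-vanishes H n<j ≤-refl)))
               ]′ (≤-<-connex j n)

-- Decidability of uniqueness

χ-harm-≗? : ∀ {n} (G H : Graph n) → Dec (χ-harm G ≗ χ-harm H)
χ-harm-≗? {n} G H = map′
  (λ agree → χ-harm-determined G H λ k k≤n →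
    subst (λ k → χ-harm G k ≡ χ-harm H k) (toℕ-fromℕ< (s≤s k≤n)) (agree (fromℕ< (s≤s k≤n))))
  (λ eq c → eq (toℕ c))
  (all? {suc n} λ c → χ-harm G (toℕ c) ℕ.≟ χ-harm H (toℕ c))

isMate? : ∀ {n} (G H : Graph n) → Dec (IsMate χ-harm H G)
isMate? G H = χ-harm-≗? G H ×-dec ¬? (H ≅? G)

module _ {n : ℕ} (G : Graph n) where

  -- A mate has the same number of vertices by `χ-harm-order`, so up to isomorphism it occurs among
  -- the finitely many codes.
  noMate⇒unique : ¬ Any (λ v → IsMate χ-harm (decode n v) G) (codes n) → Unique χ-harm G
  noMate⇒unique ¬a (m , H , mate) = noMate H (χ-harm-order G H (proj₁ mate)) mate
    where
    noMate : ∀ {m} (H : Graph m) → n ≡ m → ¬ IsMate χ-harm H G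
    noMate H refl (eq , H≇G) = ¬a (lose (∈-codes n v)
      ( (λ k → trans (eq k) (χ-harm-≗ H (decode n v) (λ x y → sym (same x y)) k))
      , λ v≅G → H≇G (≅-trans {G = H} {decode n v} {G} (≅-sym {G = decode n v} {H} (decode-encode-≅ H))
          v≅G)))
      where
      v = encode (adj H)
      same = adj-decode-encode (adj H) (symmetric H) (adj-loop H)

  abstract
    unique? : Dec (Unique χ-harm G)
    unique? = map′ noMate⇒unique
      (λ unique a → let v , _ , mate = find a in unique (n , decode n v , mate))
      (¬? (Any.any? (λ v → isMate? G (decode n v)) (codes n)))

unique-≗ : ∀ {n} (G H : Graph n) → (∀ x y → adj G x y ≡ adj H x y) → Unique χ-harm G → Unique χ-harm H
unique-≗ G H eq unique (m , K , χ≗ , K≇H) = unique (m , K , (λ k → trans (χ-harm-≗ G H eq k) (χ≗ k)) ,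
  λ K≅G → K≇H (≅-trans {G = K} {G} {H} K≅G (≗⇒≅ {G = G} {H} eq)))

U-finite : ∀ n → ∃ (HasCardinality (U χ-harm n))
U-finite n = finite-setoid (U χ-harm n) (λ p q → proj₁ p ≅? proj₁ q)
  (filterΣ (λ G → unique? G) (List.map (decode n) (codes n))) λ { (G , unique) →
  let v    = encode (adj G)
      same = adj-decode-encode (adj G) (symmetric G) (adj-loop G)
  in Any.map (λ {p} p≡v → subst (G ≅_) (sym p≡v) (≅-sym {G = decode n v} {G} (decode-encode-≅ G)))
       (∈-filterΣ (λ G → unique? G) (∈-map⁺ (decode n) (∈-codes n v))
           (unique-≗ G (decode n v) (λ x y → sym (same x y)) unique)) }

-- Graphs of diameter at most two

completeGraph : ∀ n → Graph n
completeGraph n = record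
  { adj       = λ x y → not (does (x ≟ y))
  ; symmetric = sym′
  ; loopless  = irr
  }
  where
  sym′ : ∀ (x y : Fin n) → not (does (x ≟ y)) ≡ not (does (y ≟ x))
  sym′ x y with x ≟ y | y ≟ x
  ... | yes _ | yes _ = refl
  ... | no  _ | no  _ = refl
  ... | yes p | no ¬q = contradiction (sym p) ¬q
  ... | no ¬p | yes q = contradiction (sym q) ¬p
  irr : ∀ (x : Fin n) → ¬ T (not (does (x ≟ x)))
  irr x with x ≟ x
  ... | no ¬p = contradiction refl ¬p
  ... | yes _ = id

completeGraph-adj : ∀ {n} {x y : Fin n} → x ≢ y → Adj (completeGraph n) x y
completeGraph-adj {x = x} {y} x≢y with x ≟ y
... | yes p = contradiction p x≢y
... | no  _ = _

completeGraph-diameter : ∀ n → Diameter≤2 (completeGraph n)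
completeGraph-diameter n x y with x ≟ y
... | yes p = inj₁ p
... | no ¬p = inj₂ (inj₁ _)

starGraph : ∀ n → Graph (suc n)
starGraph n = record { adj = a ; symmetric = sym′ ; loopless = irr }
  where
  a : Fin (suc n) → Fin (suc n) → Bool
  a zero    (suc _) = true
  a (suc _) zero    = true
  a _       _       = false
  sym′ : ∀ x y → a x y ≡ a y x
  sym′ zero    zero    = refl
  sym′ zero    (suc _) = refl
  sym′ (suc _) zero    = refl
  sym′ (suc _) (suc _) = refl
  irr : ∀ x → ¬ T (a x x)
  irr zero    = id
  irr (suc _) = id

starGraph-diameter : ∀ n → Diameter≤2 (starGraph n)
starGraph-diameter n zero    zero    = inj₁ refl
starGraph-diameter n zero    (suc y) = inj₂ (inj₁ _)
starGraph-diameter n (suc x) zero    = inj₂ (inj₁ _)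
starGraph-diameter n (suc x) (suc y) = inj₂ (inj₂ (zero , _ , _))

-- Vertices 1 and 2 are leaves of the star and not adjacent, whereas all distinct vertices of a
-- complete graph are adjacent.
star≇complete : ∀ n → ¬ (starGraph (2 + n) ≅ completeGraph (3 + n))
star≇complete n (φ , iso) = subst T (sym (iso (suc zero) (suc (suc zero))))
  (completeGraph-adj λ eq → 1≢2 (trans (sym (φ.strictlyInverseʳ (suc zero)))
      (trans (cong φ.from eq) (φ.strictlyInverseʳ (suc (suc zero))))))
  where
  module φ = Inverse φ
  1≢2 : ¬ (suc zero ≡ suc (suc {suc n} zero))
  1≢2 ()

-- `G` cannot be isomorphic to both `S` and `K`, and whichever it differs from is a mate. The double
-- negations avoid deciding which one it is.
diameter≤2⇒¬unique : ∀ {n} (G K S : Graph n) → Diameter≤2 G → Diameter≤2 K → Diameter≤2 S →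
  ¬ (S ≅ K) → ¬ Unique χ-harm G
diameter≤2⇒¬unique {n} G K S dG dK dS S≇K unique = ¬S≇G λ S≅G → ¬K≇G λ K≅G →
  S≇K (≅-trans {G = S} {G} {K} S≅G (≅-sym {G = K} {G} K≅G))
  where
  ¬K≇G : ¬ ¬ (K ≅ G)
  ¬K≇G K≇G = unique (n , K , χ-harm-diameter≤2 G K dG dK , K≇G)
  ¬S≇G : ¬ ¬ (S ≅ G)
  ¬S≇G S≇G = unique (n , S , χ-harm-diameter≤2 G S dG dS , S≇G)

unique⇒¬diameter≤2 : ∀ n (G : Graph (3 + n)) → Unique χ-harm G → ¬ Diameter≤2 G
unique⇒¬diameter≤2 n G unique diam = diameter≤2⇒¬unique G (completeGraph (3 + n)) (starGraph (2 + n))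
  diam (completeGraph-diameter (3 + n)) (starGraph-diameter (2 + n)) (star≇complete n) unique

close? : ∀ {n} (G : Graph n) x y → Dec (Close G x y)
close? G x y = (x ≟ y) ⊎-dec (T? (adj G x y) ⊎-dec Fin.any? λ w → T? (adj G x w) ×-dec T? (adj G y w))

diameter≤2? : ∀ {n} (G : Graph n) → Dec (Diameter≤2 G)
diameter≤2? G = all? λ x → all? λ y → close? G x y

diameter≤2-≅ : ∀ {n} {G H : Graph n} → G ≅ H → Diameter≤2 H → Diameter≤2 G
diameter≤2-≅ {G = G} {H} (φ , iso) diam x y with diam (Inverse.to φ x) (Inverse.to φ y)
... | inj₁ eq = inj₁ (trans (sym (φ.strictlyInverseʳ x)) (trans (cong φ.from eq) (φ.strictlyInverseʳ y)))
  where module φ = Inverse φ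
... | inj₂ (inj₁ xy) = inj₂ (inj₁ (subst T (sym (iso x y)) xy))
... | inj₂ (inj₂ (w , xw , yw)) = inj₂ (inj₂ (φ.from w , back x xw , back y yw))
  where
  module φ = Inverse φ
  back : ∀ z → Adj H (φ.to z) w → Adj G z (φ.from w)
  back z zw = subst T (sym (trans (iso z (φ.from w)) (cong (adj H (φ.to z)) (φ.strictlyInverseˡ w)))) zw

-- Labelled graphs of diameter greater than two

¬diameter≤2⇒∃ : ∀ {n} (G : Graph n) → ¬ Diameter≤2 G → ∃ λ x → ∃ λ y → ¬ Close G x y
¬diameter≤2⇒∃ {n} G ¬diam =
  let x , ¬x = ¬∀⟶∃¬ n _ (λ x → all? (close? G x)) ¬diam
      y , ¬y = ¬∀⟶∃¬ n _ (close? G x) ¬x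
  in x , y , ¬y

module _ {m : ℕ} (x : Fin (2 + m)) (y : Fin (1 + m)) where

  rest : Fin m → Fin (2 + m)
  rest w = punchIn x (punchIn y w)

  data Position : Fin (2 + m) → Set where
    first  : Position x
    second : Position (punchIn x y)
    other  : ∀ w → Position (rest w)

  position : ∀ z → Position z
  position z with x ≟ z
  ... | yes refl = first
  ... | no x≢z with y ≟ punchOut x≢z
  ...   | yes y≡z = subst Position (trans (cong (punchIn x) y≡z) (punchIn-punchOut x≢z)) second
  ...   | no  y≢z = subst Position (trans (cong (punchIn x) (punchIn-punchOut y≢z))
      (punchIn-punchOut x≢z)) (other (punchOut y≢z))

-- The source of the base 3/4: without a common neighbour, two vertices meet each further vertex in
-- only three of the four adjacency patterns.
notBoth : List (Bool × Bool)
notBoth = (false , false) ∷ (false , true) ∷ (true , false) ∷ []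

∈-notBoth : ∀ {a b} → ¬ (T a × T b) → (a , b) ∈ notBoth
∈-notBoth {false} {false} _ = here refl
∈-notBoth {false} {true}  _ = there (here refl)
∈-notBoth {true}  {false} _ = there (there (here refl))
∈-notBoth {true}  {true}  h = contradiction _ h

Far : ∀ n → Pred (Code n) 0ℓ
Far n v = ¬ Diameter≤2 (decode n v)

far? : ∀ n → Decidable (Far n)
far? n v = ¬? (diameter≤2? (decode n v))

module FarGraphs (m : ℕ) where

  Data : Set
  Data = (Fin (2 + m) × Fin (1 + m)) × (Vec (Bool × Bool) m × Code m)

  -- The second vertex is punchIn x y; p lists the adjacencies of the two vertices to the others.
  Describes : Graph (2 + m) → Data → Set
  Describes G ((x , y) , (p , c)) =
    adj G x (punchIn x y) ≡ false ×
    (∀ w → lookup p w ≡ (adj G x (rest x y w) , adj G (punchIn x y) (rest x y w))) ×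
    (∀ a b → adj (decode m c) a b ≡ adj G (rest x y a) (rest x y b))

  describes-injective : ∀ {G H} d → Describes G d → Describes H d → ∀ a b → adj G a b ≡ adj H a b
  describes-injective {G} {H} ((x , y) , (p , c)) (G₀ , Gp , Gc) (H₀ , Hp , Hc) a b =
    agree (position x y a) (position x y b)
    where
    flip′ : ∀ {a b} → adj G a b ≡ adj H a b → adj G b a ≡ adj H b a
    flip′ {a} {b} eq = trans (symmetric G b a) (trans eq (symmetric H a b))
    rows : ∀ w → (adj G x (rest x y w) , adj G (punchIn x y) (rest x y w)) ≡
        (adj H x (rest x y w) , adj H (punchIn x y) (rest x y w))
    rows w = trans (sym (Gp w)) (Hp w)
    agree : ∀ {a b} → Position x y a → Position x y b → adj G a b ≡ adj H a b
    agree first      first      = trans (adj-loop G _) (sym (adj-loop H _))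
    agree first      second     = trans G₀ (sym H₀)
    agree first      (other w)  = cong proj₁ (rows w)
    agree second     first      = flip′ (trans G₀ (sym H₀))
    agree second     second     = trans (adj-loop G _) (sym (adj-loop H _))
    agree second     (other w)  = cong proj₂ (rows w)
    agree (other w)  first      = flip′ (cong proj₁ (rows w))
    agree (other w)  second     = flip′ (cong proj₂ (rows w))
    agree (other w)  (other w′) = trans (sym (Gc w w′)) (Hc w w′)

  dataList : List Data
  dataList = cartesianProduct (cartesianProduct (allFin (2 + m)) (allFin (1 + m)))
      (cartesianProduct (vectors notBoth m) (codes m))

  length-dataList : length dataList ≡ ((2 + m) * (1 + m)) * (3 ^ m * 2 ^ tri m)
  length-dataList = trans (length-cartesianProduct (cartesianProduct (allFin (2 + m)) (allFin (1 + m)))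
      (cartesianProduct (vectors notBoth m) (codes m)))
    (cong₂ _*_
      (trans (length-cartesianProduct (allFin (2 + m)) (allFin (1 + m)))
        (cong₂ _*_ (length-tabulate {n = 2 + m} id) (length-tabulate {n = 1 + m} id)))
      (trans (length-cartesianProduct (vectors notBoth m) (codes m))
          (cong₂ _*_ (length-vectors notBoth m) (length-codes m))))

  describe : ∀ (G : Graph (2 + m)) → ¬ Diameter≤2 G → ∃ λ d → d ∈ dataList × Describes G d
  describe G ¬diam with ¬diameter≤2⇒∃ G ¬diam
  ... | x , y , ¬close = ((x , y′) , (p , c)) ,
    ∈-cartesianProduct⁺ (∈-cartesianProduct⁺ (∈-allFin x) (∈-allFin y′)) (∈-cartesianProduct⁺
      (∈-vectors p λ w → subst (_∈ notBoth) (sym (p-lookup w))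
          (∈-notBoth (λ common → ¬common (rest x y′ w , common))))
      (∈-codes m c)) ,
    ¬T⇒≡false (subst (λ z → ¬ Adj G x z) (sym y-eq) (¬close ∘ inj₂ ∘ inj₁)) , p-lookup ,
    adj-decode-encode _ (λ a b → symmetric G _ _) (λ a → adj-loop G _)
    where
    x≢y : x ≢ y
    x≢y = ¬close ∘ inj₁
    y′ = punchOut x≢y
    y-eq : punchIn x y′ ≡ y
    y-eq = punchIn-punchOut x≢y
    ¬common : ¬ ∃ λ w → Adj G x w × Adj G (punchIn x y′) w
    ¬common = subst (λ z → ¬ ∃ λ w → Adj G x w × Adj G z w) (sym y-eq) (¬close ∘ inj₂ ∘ inj₂)
    p = Vec.tabulate λ w → adj G x (rest x y′ w) , adj G (punchIn x y′) (rest x y′ w)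
    p-lookup = Vec.lookup∘tabulate (λ w → adj G x (rest x y′ w) , adj G (punchIn x y′) (rest x y′ w))
    c = encode (λ a b → adj G (rest x y′ a) (rest x y′ b))

  -- The factors count ordered pairs of distinct vertices, their adjacencies to the m others, and
  -- the graph on those others. All labelled graphs number 2 * 4 ^ m * 2 ^ `tri m`, whence the
  -- fraction O(n² (3/4)ⁿ).
  count-far : length (filter (far? (2 + m)) (codes (2 + m))) ≤ ((2 + m) * (1 + m)) * (3 ^ m * 2 ^ tri m)
  count-far = subst (length (filter (far? (2 + m)) (codes (2 + m))) ≤_) length-dataList
    (length-≤-relation (filter (far? (2 + m)) (codes (2 + m))) dataList (λ v → Describes (decode (2 + m) v))
      (Distinct.filter⁺ (far? (2 + m)) (codes-distinct (2 + m)))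
      (λ {v} v∈ → describe (decode (2 + m) v) (proj₂ (∈-filter⁻ (far? (2 + m)) {xs = codes (2 + m)} v∈)))
      (λ {v} {w} {d} _ _ p q → decode-injective (2 + m) {v} {w}
          (describes-injective {decode (2 + m) v} {decode (2 + m) w} d p q)))

-- Bit vectors invariant under a map of their positions

map-fromList-≡ : {A B : Set} {g h : A → B} (xs : List A) → Vec.map g (Vec.fromList xs) ≡ Vec.map h
    (Vec.fromList xs) →
  ∀ {x} → x ∈ xs → g x ≡ h x
map-fromList-≡ (x ∷ xs) eq (here refl) = Vec.∷-injectiveˡ eq
map-fromList-≡ (x ∷ xs) eq (there x∈)  = map-fromList-≡ xs (Vec.∷-injectiveʳ eq) x∈

module _ {N : ℕ} (f : Fin N → Fin N) {_≺_ : Rel (Fin N) 0ℓ} (wf : WellFounded _≺_)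
    (descends? : ∀ i → Dec (f i ≺ i)) where

  -- The bits at positions i with f i ≺ i are determined by the other bits.
  count-invariant : (vs : List (Vec Bool N)) → Distinct vs →
    (∀ {v} → v ∈ vs → ∀ i → lookup v (f i) ≡ lookup v i) →
    length vs * 2 ^ length (filter descends? (allFin N)) ≤ 2 ^ N
  count-invariant vs d invariant = begin
    length vs * 2 ^ length down       ≤⟨ *-monoˡ-≤ (2 ^ length down) bound ⟩
    2 ^ length free * 2 ^ length down ≡⟨ sym (^-distribˡ-+-* 2 (length free) (length down)) ⟩
    2 ^ (length free + length down)   ≡⟨ cong (2 ^_)
        (trans (length-filter-¬ descends? (allFin N)) (length-tabulate {n = N} id)) ⟩
    2 ^ N                             ∎
    where
    open ≤-Reasoning
    down = filter descends? (allFin N)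
    free = filter (¬? ∘ descends?) (allFin N)
    restrict : Vec Bool N → Vec Bool (length free)
    restrict v = Vec.map (lookup v) (Vec.fromList free)
    recover : ∀ {v w} → v ∈ vs → w ∈ vs → restrict v ≡ restrict w → ∀ i → Acc _≺_ i → lookup v i ≡
        lookup w i
    recover v∈ w∈ eq i (acc rs) with descends? i
    ... | yes fi≺i = trans (sym (invariant v∈ i))
        (trans (recover v∈ w∈ eq (f i) (rs fi≺i)) (invariant w∈ i))
    ... | no  fi⊀i = map-fromList-≡ free eq (∈-filter⁺ (¬? ∘ descends?) (∈-allFin i) fi⊀i)
    bound : length vs ≤ 2 ^ length free
    bound = subst (length vs ≤_) (length-vectors bools (length free))
      (length-≤-injection vs (vectors bools (length free)) restrict d
        (λ _ → ∈-vectors _ (λ i → ∈-bools _))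
        (λ v∈ w∈ eq → lookup-injective λ i → recover v∈ w∈ eq i (wf i)))

-- Vertex pairs moved by an injective map of the vertices

module Invariant {n : ℕ} (α : Vec (Fin n) n) (α-injective : ∀ x y → lookup α x ≡ lookup α y → x ≡ y) where

  -- The action of α on unordered pairs. The default i is never taken: α is injective, so the images
  -- of two distinct ends are distinct.
  movePos : Fin (tri n) → Fin (tri n)
  movePos i = fromMaybe i (pos (lookup α (proj₁ (ends n i))) (lookup α (proj₂ (ends n i))))

  invariant-bits : ∀ v → IsoVia (decode n v) (decode n v) α → ∀ i → lookup v (movePos i) ≡ lookup v i
  invariant-bits v iso i = go (pos (lookup α (proj₁ (ends n i))) (lookup α (proj₂ (ends n i)))) refl
    where
    go : ∀ m → pos (lookup α (proj₁ (ends n i))) (lookup α (proj₂ (ends n i))) ≡ m →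
      lookup v (fromMaybe i m) ≡ lookup v i
    go nothing  _  = refl
    go (just j) eq = trans (sym (cong (maybe′ (lookup v) false) eq))
      (trans (sym (iso (proj₁ (ends n i)) (proj₂ (ends n i)))) (adj-decode-ends n v i))

  moved? : ∀ x → Dec (¬ (lookup α x ≡ x))
  moved? x = ¬? (lookup α x ≟ x)

  moved = filter moved? (allFin n)
  down = filter (λ i → movePos i Fin.<? i) (allFin (tri n))
  up   = filter (λ i → i Fin.<? movePos i) (allFin (tri n))

  -- If α fixes the pair {x, y} but not x, it must send x to y.
  movePos-moves : ∀ {x y i} → pos x y ≡ just i → lookup α x ≢ x → y ≢ lookup α x → movePos i ≢ i
  movePos-moves {x} {y} {i} eq αx≢x y≢αx fixed = impossible (ends-pos x y eq)
    where
    αpos : pos (lookup α (proj₁ (ends n i))) (lookup α (proj₂ (ends n i))) ≡ just i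
    αpos with pos (lookup α (proj₁ (ends n i))) (lookup α (proj₂ (ends n i))) in eq′
    ... | just j  = cong just fixed
    ... | nothing = contradiction (trans (sym (pos-ends n i))
        (trans (cong (pos (proj₁ (ends n i))) (sym same)) (pos-diagonal (proj₁ (ends n i))))) λ ()
      where
      same : proj₁ (ends n i) ≡ proj₂ (ends n i)
      same = α-injective (proj₁ (ends n i)) (proj₂ (ends n i))
          (pos-nothing (lookup α (proj₁ (ends n i))) (lookup α (proj₂ (ends n i))) eq′)
    impossible : ¬ SamePair (ends n i) (x , y)
    impossible (inj₁ (p , q)) with pos-injective (lookup α (proj₁ (ends n i)))
        (lookup α (proj₂ (ends n i))) x y αpos eq
    ... | inj₁ (r , _) = αx≢x (trans (cong (lookup α) (sym p)) r)
    ... | inj₂ (r , _) = y≢αx (trans (sym r) (cong (lookup α) p))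
    impossible (inj₂ (p , q)) with pos-injective (lookup α (proj₁ (ends n i)))
        (lookup α (proj₂ (ends n i))) x y αpos eq
    ... | inj₁ (_ , r) = y≢αx (trans (sym r) (cong (lookup α) q))
    ... | inj₂ (_ , r) = αx≢x (trans (cong (lookup α) (sym q)) r)

  ∈-down++up : ∀ {i} → movePos i ≢ i → i ∈ down ++ up
  ∈-down++up {i} ≢i with Fin.<-cmp (movePos i) i
  ... | tri< <i _ _ = ∈-++⁺ˡ (∈-filter⁺ (λ i → movePos i Fin.<? i) (∈-allFin i) <i)
  ... | tri≈ _ ≡i _ = contradiction ≡i ≢i
  ... | tri> _ _ >i = ∈-++⁺ʳ down (∈-filter⁺ (λ i → i Fin.<? movePos i) (∈-allFin i) >i)

  -- Tags for a double count of the pairs (x, y) with x moved. Such a pair is charged to its moved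
  -- position, with a bit for the order of x and y, or to x itself, with a bit telling whether y is
  -- x or its image.
  Tag : Set
  Tag = (Fin (tri n) × Bool) ⊎ (Fin n × Bool)

  tags : List Tag
  tags = map inj₁ (cartesianProduct (down ++ up) bools) ++ map inj₂ (cartesianProduct moved bools)

  length-tags : length tags ≡ (length down + length up) * 2 + length moved * 2
  length-tags = trans (length-++ (map inj₁ (cartesianProduct (down ++ up) bools))) (cong₂ _+_
    (trans (length-map inj₁ (cartesianProduct (down ++ up) bools))
        (trans (length-cartesianProduct (down ++ up) bools) (cong (_* 2) (length-++ down))))
    (trans (length-map inj₂ (cartesianProduct moved bools)) (length-cartesianProduct moved bools)))

  Tagged : Fin n × Fin n → Tag → Set
  Tagged (x , y) (inj₁ (i , false)) = pos x y ≡ just i × ¬ (x Fin.< y)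
  Tagged (x , y) (inj₁ (i , true))  = pos x y ≡ just i × x Fin.< y
  Tagged (x , y) (inj₂ (z , false)) = z ≡ x × y ≡ x
  Tagged (x , y) (inj₂ (z , true))  = z ≡ x × y ≡ lookup α x

  tagged-injective : ∀ {p q} t → Tagged p t → Tagged q t → p ≡ q
  tagged-injective {x , y} {x′ , y′} (inj₁ (i , false)) (p , x≮y) (p′ , y≮x) with pos-injective x y x′
      y′ p p′
  ... | inj₁ (refl , refl) = refl
  ... | inj₂ (refl , refl) = cong₂ _,_ x≡y (sym x≡y)
    where x≡y = Fin.toℕ-injective (≤-antisym (≮⇒≥ y≮x) (≮⇒≥ x≮y))
  tagged-injective {x , y} {x′ , y′} (inj₁ (i , true)) (p , x<y) (p′ , y<x) with pos-injective x y x′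
      y′ p p′
  ... | inj₁ (refl , refl) = refl
  ... | inj₂ (refl , refl) = contradiction y<x (<⇒≯ x<y)
  tagged-injective (inj₂ (z , false)) (refl , refl) (refl , refl) = refl
  tagged-injective (inj₂ (z , true))  (refl , refl) (refl , refl) = refl

  tag : ∀ {x y} → x ∈ moved → ∃ λ t → t ∈ tags × Tagged (x , y) t
  tag {x} {y} x∈ with y ≟ x
  ... | yes y≡x = inj₂ (x , false) ,
    ∈-++⁺ʳ (map inj₁ (cartesianProduct (down ++ up) bools))
        (∈-map⁺ inj₂ (∈-cartesianProduct⁺ x∈ (∈-bools false))) , refl , y≡x
  ... | no y≢x with y ≟ lookup α x
  ...   | yes y≡αx = inj₂ (x , true) ,
    ∈-++⁺ʳ (map inj₁ (cartesianProduct (down ++ up) bools))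
        (∈-map⁺ inj₂ (∈-cartesianProduct⁺ x∈ (∈-bools true))) , refl , y≡αx
  ...   | no y≢αx with pos x y in eq
  ...     | nothing = contradiction (sym (pos-nothing x y eq)) y≢x
  ...     | just i with x Fin.<? y
  ...       | yes x<y = inj₁ (i , true) , ∈-++⁺ˡ
      (∈-map⁺ inj₁ (∈-cartesianProduct⁺ (∈-down++up (movePos-moves eq αx≢x y≢αx)) (∈-bools true))) ,
      eq , x<y
    where αx≢x = proj₂ (∈-filter⁻ moved? {xs = allFin n} x∈)
  ...       | no  x≮y = inj₁ (i , false) , ∈-++⁺ˡ
      (∈-map⁺ inj₁ (∈-cartesianProduct⁺ (∈-down++up (movePos-moves eq αx≢x y≢αx)) (∈-bools false))) ,
      eq , x≮y
    where αx≢x = proj₂ (∈-filter⁻ moved? {xs = allFin n} x∈)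

  -- With k moved vertices this says that at least k(n-2)/2 positions move: each takes at most two
  -- charges, and each moved vertex has two exceptional partners.
  moved-positions : length moved * n ≤ (length down + length up) * 2 + length moved * 2
  moved-positions = begin
    length moved * n
        ≡⟨ cong (length moved *_) (sym (length-tabulate {n = n} id)) ⟩
    length moved * length (allFin n)            ≡⟨ sym (length-cartesianProduct moved (allFin n)) ⟩
    length (cartesianProduct moved (allFin n))
        ≤⟨ length-≤-relation (cartesianProduct moved (allFin n)) tags Tagged
      (Distinct.cartesianProduct⁺ (Distinct.filter⁺ moved? (Distinct.allFin⁺ n)) (Distinct.allFin⁺ n))
      (λ p∈ → tag (proj₁ (∈-cartesianProduct⁻ moved (allFin n) p∈)))
      (λ {_} {_} {t} _ _ → tagged-injective t) ⟩
    length tags                                 ≡⟨ length-tags ⟩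
    (length down + length up) * 2 + length moved * 2 ∎
    where open ≤-Reasoning

  module _ (vs : List (Code n)) (d : Distinct vs)
      (invariant : ∀ {v} → v ∈ vs → IsoVia (decode n v) (decode n v) α) where

    -- Applying `count-invariant` once for < and once for > and multiplying lets every moved
    -- position count, whatever the cycles of `movePos` look like.
    square-bound : length vs * length vs * 2 ^ (length down + length up) ≤ 2 ^ tri n * 2 ^ tri n
    square-bound = begin
      length vs * length vs * 2 ^ (length down + length up)
        ≡⟨ cong (length vs * length vs *_) (^-distribˡ-+-* 2 (length down) (length up)) ⟩
      length vs * length vs * (2 ^ length down * 2 ^ length up)
        ≡⟨ solve 3 (λ s a b → s :* s :* (a :* b) := (s :* a) :* (s :* b)) refl (length vs)
            (2 ^ length down) (2 ^ length up) ⟩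
      (length vs * 2 ^ length down) * (length vs * 2 ^ length up)
        ≤⟨ *-mono-≤ (count-invariant movePos <-wellFounded (λ i → movePos i Fin.<? i) vs d
            (λ {v} v∈ → invariant-bits v (invariant v∈)))
                    (count-invariant movePos >-wellFounded (λ i → i Fin.<? movePos i) vs d
                        (λ {v} v∈ → invariant-bits v (invariant v∈))) ⟩
      2 ^ tri n * 2 ^ tri n ∎
      where
      open ≤-Reasoning
      open +-*-Solver

    -- The square root of `square-bound`: the hypothesis on e gives 2ek ≤ k(n-2)/2, which is at most
    -- the number of moved positions.
    count-automorphic : ∀ e → 4 * e + 2 ≤ n → length vs * (2 ^ e) ^ length moved ≤ 2 ^ tri n
    count-automorphic e 4e+2≤n = square-cancel-≤ (begin
      (s * (2 ^ e) ^ k) * (s * (2 ^ e) ^ k)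
          ≡⟨ solve 2 (λ s a → (s :* a) :* (s :* a) := s :* s :* (a :* a)) refl s ((2 ^ e) ^ k) ⟩
      s * s * ((2 ^ e) ^ k * (2 ^ e) ^ k)     ≡⟨ cong (λ z → s * s * (z * z)) (^-*-assoc 2 e k) ⟩
      s * s * (2 ^ (e * k) * 2 ^ (e * k))     ≡⟨ cong (s * s *_) (sym (^-distribˡ-+-* 2 (e * k) (e * k))) ⟩
      s * s * 2 ^ (e * k + e * k)             ≤⟨ *-monoʳ-≤ (s * s) (^-monoʳ-≤ 2 exponent) ⟩
      s * s * 2 ^ (length down + length up)   ≤⟨ square-bound ⟩
      2 ^ tri n * 2 ^ tri n                   ∎)
      where
      open ≤-Reasoning
      open +-*-Solver
      s = length vs
      k = length moved
      square-cancel-≤ : ∀ {a b} → a * a ≤ b * b → a ≤ b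
      square-cancel-≤ {a} {b} aa≤bb = ≮⇒≥ λ b<a → <⇒≱ (*-mono-< b<a b<a) aa≤bb
      -- Doubling both sides and adding 2k brings the claim to the form of `moved-positions`.
      exponent : e * k + e * k ≤ length down + length up
      exponent = *-cancelʳ-≤ _ _ 2 (+-cancelʳ-≤ (k * 2) _ _ (begin
        (e * k + e * k) * 2 + k * 2  ≡⟨ solve 2
            (λ e k → (e :* k :+ e :* k) :* con 2 :+ k :* con 2 := k :* (con 4 :* e :+ con 2)) refl e k ⟩
        k * (4 * e + 2)              ≤⟨ *-monoʳ-≤ k 4e+2≤n ⟩
        k * n                        ≤⟨ moved-positions ⟩
        (length down + length up) * 2 + k * 2 ∎))

-- Pairs of a labelled graph and an automorphism

AutomorphicFar : ∀ n → Pred (Vec (Fin n) n × Code n) 0ℓ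
AutomorphicFar n (α , v) = Automorphic α (decode n v) × Far n v

automorphicFar? : ∀ n → Decidable (AutomorphicFar n)
automorphicFar? n (α , v) =
  (all? (λ x → all? λ y → (lookup α x ≟ lookup α y) →-dec (x ≟ y)) ×-dec isoVia? (decode n v)
      (decode n v) α)
  ×-dec far? n v

module _ {A : Set} {Q : Pred A 0ℓ} (Q? : Decidable Q) (X : ℕ) where

  pick : A → ℕ
  pick x = if does (Q? x) then X else 1

  pow-split : ∀ xs → X ^ length xs ≡ X ^ length (filter (¬? ∘ Q?) xs) * product (map pick xs)
  pow-split [] = refl
  pow-split (x ∷ xs) with Q? x
  ... | yes _ = begin
    X * X ^ length xs                                    ≡⟨ cong (X *_) (pow-split xs) ⟩
    X * (X ^ length (filter (¬? ∘ Q?) xs) * product (map pick xs))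
      ≡⟨ solve 3 (λ x a b → x :* (a :* b) := a :* (x :* b)) refl X (X ^ length (filter (¬? ∘ Q?) xs))
          (product (map pick xs)) ⟩
    X ^ length (filter (¬? ∘ Q?) xs) * (X * product (map pick xs)) ∎
    where
    open ≡-Reasoning
    open +-*-Solver
  ... | no _ = begin
    X * X ^ length xs                                    ≡⟨ cong (X *_) (pow-split xs) ⟩
    X * (X ^ length (filter (¬? ∘ Q?) xs) * product (map pick xs))
      ≡⟨ solve 3 (λ x a b → x :* (a :* b) := x :* a :* (b :+ con 0)) refl X
          (X ^ length (filter (¬? ∘ Q?) xs)) (product (map pick xs)) ⟩
    X * X ^ length (filter (¬? ∘ Q?) xs) * (product (map pick xs) + 0) ∎
    where
    open ≡-Reasoning
    open +-*-Solver

module _ (n X : ℕ) where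

  factorAt : Fin n → Fin n → ℕ
  factorAt i b = if does (b ≟ i) then X else 1

  -- `X` to the number of fixed points of α, that is, Xⁿ X^(-k) for k moved vertices, free of
  -- denominators and a product over the vertices.
  weight : Vec (Fin n) n → ℕ
  weight α = product (tabulate λ i → factorAt i (lookup α i))

  weight-moved : ∀ α → X ^ n ≡ X ^ length (filter (λ x → ¬? (lookup α x ≟ x)) (allFin n)) * weight α
  weight-moved α = begin
    X ^ n                     ≡⟨ cong (X ^_) (sym (length-tabulate {n = n} id)) ⟩
    X ^ length (allFin n)     ≡⟨ pow-split (λ x → lookup α x ≟ x) X (allFin n) ⟩
    X ^ k * product (map (λ i → factorAt i (lookup α i)) (allFin n))
                              ≡⟨ cong (λ xs → X ^ k * product xs)
                                  (map-tabulate {n = n} id (λ i → factorAt i (lookup α i))) ⟩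
    X ^ k * weight α          ∎
    where
    open ≡-Reasoning
    k = length (filter (λ x → ¬? (lookup α x ≟ x)) (allFin n))

  weight-identity : weight (Vec.allFin n) ≡ X ^ n
  weight-identity = sym (trans (weight-moved (Vec.allFin n)) (trans
    (cong (λ xs → X ^ length xs * weight (Vec.allFin n))
      (filter-none (λ x → ¬? (lookup (Vec.allFin n) x ≟ x))
          (All.universal (λ x moved → moved (Vec.lookup-allFin x)) (allFin n))))
    (*-identityˡ _)))

  -- The sum factorises over the vertices: at each i the image i contributes `X` and every other
  -- image 1.
  ∑-weight : ∑ (maps n) weight ≤ (X + n) ^ n
  ∑-weight = ∑-vectors-product (allFin n) n factorAt λ i → begin
    -- The added 1 is the term of i in the constant sum, as `∑-mono-except` requires; it turns the
    -- exact X + n - 1 into X + n.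
    ∑ (allFin n) (factorAt i)        ≤⟨ m≤m+n _ 1 ⟩
    ∑ (allFin n) (factorAt i) + 1    ≤⟨ ∑-mono-except {h = λ _ → 1} (Distinct.allFin⁺ n) (∈-allFin i)
        (at i) off ⟩
    X + ∑ (allFin n) (λ _ → 1)       ≡⟨ cong (_+_ X)
        (trans (∑-const (allFin n) 1) (trans (*-identityʳ _) (length-tabulate {n = n} id))) ⟩
    X + n                            ∎
    where
    open ≤-Reasoning
    at : ∀ i → factorAt i i ≤ X
    at i with i ≟ i
    ... | yes _ = ≤-refl
    ... | no ¬p = contradiction refl ¬p
    off : ∀ {i b} → b ≢ i → factorAt i b ≤ 1
    off {i} {b} b≢i with b ≟ i
    ... | yes p = contradiction p b≢i
    ... | no _  = ≤-refl

module _ (n e : ℕ) (4e+2≤n : 4 * e + 2 ≤ n) where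

  private
    X = 2 ^ e
    L = 2 ^ tri n

  automorphicCount : Vec (Fin n) n → ℕ
  automorphicCount α = length (filter (λ v → automorphicFar? n (α , v)) (codes n))

  -- A map that is not injective contributes no pairs; for the others this is `count-automorphic`
  -- multiplied by the weight.
  automorphicCount-≤ : ∀ α → X ^ n * automorphicCount α ≤ L * weight n X α
  automorphicCount-≤ α with all? (λ x → all? λ y → (lookup α x ≟ lookup α y) →-dec (x ≟ y))
  ... | no ¬inj = subst (_≤ L * weight n X α)
      (sym (trans (cong (λ xs → X ^ n * length xs) none) (*-zeroʳ (X ^ n)))) z≤n
    where
    none : filter (λ v → automorphicFar? n (α , v)) (codes n) ≡ []
    none = filter-none (λ v → automorphicFar? n (α , v))
        (All.universal (λ { v ((inj , _) , _) → ¬inj inj }) (codes n))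
  ... | yes inj = begin
    X ^ n * c                        ≡⟨ cong (_* c) (weight-moved n X α) ⟩
    X ^ k * weight n X α * c         ≡⟨ solve 3 (λ a w c → a :* w :* c := (c :* a) :* w) refl (X ^ k)
        (weight n X α) c ⟩
    (c * X ^ k) * weight n X α       ≤⟨ *-monoˡ-≤ (weight n X α) (Invariant.count-automorphic α inj
                                          (filter (λ v → automorphicFar? n (α , v)) (codes n))
                                          (Distinct.filter⁺ (λ v → automorphicFar? n (α , v))
                                              (codes-distinct n))
                                          (λ v∈ → proj₂ (proj₁ (proj₂
                                              (∈-filter⁻ (λ v → automorphicFar? n (α , v))
                                              {xs = codes n} v∈))))
                                          e 4e+2≤n) ⟩
    L * weight n X α                 ∎
    where
    open ≤-Reasoning
    open +-*-Solver
    c = automorphicCount α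
    k = length (filter (λ x → ¬? (lookup α x ≟ x)) (allFin n))

  automorphicPairs : ℕ
  automorphicPairs = length (filter (automorphicFar? n) (cartesianProduct (maps n) (codes n)))

  -- Divided by Xⁿ: pairs + L ≤ far graphs + L (1 + n/X)ⁿ. The pairs of the identity are bounded by
  -- the far graphs, so its weight Xⁿ is taken out of the sum and stands on the left.
  automorphicPairs-≤ : X ^ n * automorphicPairs + L * X ^ n ≤ X ^ n * length
      (filter (far? n) (codes n)) + L * (X + n) ^ n
  automorphicPairs-≤ = begin
    X ^ n * automorphicPairs + L * X ^ n
      ≡⟨ cong₂ (λ a b → X ^ n * a + L * b)
          (length-filter-cartesianProduct (automorphicFar? n) (maps n) (codes n))
          (sym (weight-identity n X)) ⟩
    X ^ n * ∑ (maps n) automorphicCount + L * weight n X (Vec.allFin n)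
      ≡⟨ cong (_+ L * weight n X (Vec.allFin n)) (sym (∑-*ˡ (X ^ n) (maps n) automorphicCount)) ⟩
    ∑ (maps n) (λ α → X ^ n * automorphicCount α) + L * weight n X (Vec.allFin n)
      ≤⟨ ∑-mono-except {h = λ α → L * weight n X α} (maps-distinct n) (∈-maps (Vec.allFin n))
           (*-monoʳ-≤ (X ^ n) (count-≤ (λ v → automorphicFar? n (Vec.allFin n , v)) (far? n)
               (codes-distinct n) proj₂))
           (λ {α} _ → automorphicCount-≤ α) ⟩
    X ^ n * length (filter (far? n) (codes n)) + ∑ (maps n) (λ α → L * weight n X α)
      ≡⟨ cong (_+_ (X ^ n * length (filter (far? n) (codes n)))) (∑-*ˡ L (maps n) (weight n X)) ⟩
    X ^ n * length (filter (far? n) (codes n)) + L * ∑ (maps n) (weight n X)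
      ≤⟨ +-monoʳ-≤ (X ^ n * length (filter (far? n) (codes n))) (*-monoʳ-≤ L (∑-weight n X)) ⟩
    X ^ n * length (filter (far? n) (codes n)) + L * (X + n) ^ n ∎
    where open ≤-Reasoning

-- Estimates

-- (1 + a/X)ʲ (1 − ja/X) ≤ 1 without denominators, where Z = X − ja.
bernoulli : ∀ a j {X Z} → X ≡ Z + j * a → (X + a) ^ j * Z ≤ X ^ suc j
bernoulli a zero {X} {Z} eq = ≤-reflexive
    (trans (*-identityˡ Z) (trans (sym (+-identityʳ Z)) (trans (sym eq) (sym (*-identityʳ X)))))
bernoulli a (suc j) {X} {Z} eq = begin
  (X + a) * (X + a) ^ j * Z     ≡⟨ solve 3 (λ y p z → y :* p :* z := p :* (y :* z)) refl (X + a)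
      ((X + a) ^ j) Z ⟩
  (X + a) ^ j * ((X + a) * Z)   ≤⟨ *-monoʳ-≤ ((X + a) ^ j) (begin
      (X + a) * Z                 ≡⟨ *-distribʳ-+ Z X a ⟩
      X * Z + a * Z               ≤⟨ +-monoʳ-≤ (X * Z) (*-monoʳ-≤ a (subst (Z ≤_) (sym eq) (m≤m+n Z _))) ⟩
      X * Z + a * X               ≡⟨ solve 3 (λ x z a → x :* z :+ a :* x := x :* (z :+ a)) refl X Z a ⟩
      X * (Z + a)                 ∎) ⟩
  (X + a) ^ j * (X * (Z + a))   ≡⟨ solve 3 (λ p x y → p :* (x :* y) := x :* (p :* y)) refl
      ((X + a) ^ j) X (Z + a) ⟩
  X * ((X + a) ^ j * (Z + a))   ≤⟨ *-monoʳ-≤ X (bernoulli a j (trans eq (sym (+-assoc Z a (j * a))))) ⟩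
  X * X ^ suc j                 ∎
  where
  open ≤-Reasoning
  open +-*-Solver

-- This is (1 + n/X)ⁿ ≤ 1 + 1/K. Bernoulli's bound with Z = X - n² leaves K X ≤ (K + 1) Z to be
-- shown, which holds because K n² ≤ Z.
pow-+-≤ : ∀ K n X .{{_ : NonZero K}} .{{_ : NonZero n}} → suc K * (n * n) ≤ X → K * (X + n) ^ n ≤ suc K
    * X ^ n
pow-+-≤ K n X big = *-cancelʳ-≤ _ _ Z (begin
  K * (X + n) ^ n * Z              ≡⟨ *-assoc K _ Z ⟩
  K * ((X + n) ^ n * Z)            ≤⟨ *-monoʳ-≤ K (bernoulli n n X≡) ⟩
  K * (X * X ^ n)                  ≡⟨ cong (λ x → K * (x * X ^ n)) X≡ ⟩
  K * ((Z + n * n) * X ^ n)        ≡⟨ solve 4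
      (λ k z m p → k :* ((z :+ m) :* p) := (k :* z :+ k :* m) :* p) refl K Z (n * n) (X ^ n) ⟩
  (K * Z + K * (n * n)) * X ^ n    ≤⟨ *-monoˡ-≤ (X ^ n) (+-monoʳ-≤ (K * Z) K≤Z) ⟩
  (K * Z + Z) * X ^ n              ≡⟨ solve 3 (λ k z p → (k :* z :+ z) :* p := (con 1 :+ k) :* p :* z)
      refl K Z (X ^ n) ⟩
  suc K * X ^ n * Z                ∎)
  where
  open ≤-Reasoning
  open +-*-Solver
  Z = X ∸ n * n
  X≡ : X ≡ Z + n * n
  X≡ = sym (m∸n+n≡m (≤-trans (m≤m+n (n * n) (K * (n * n))) big))
  K≤Z : K * (n * n) ≤ Z
  K≤Z = m+n≤o⇒m≤o∸n (K * (n * n)) (subst (_≤ X) (+-comm (n * n) (K * (n * n))) big)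
  instance
    nonZero-n² : NonZero (n * n)
    nonZero-n² = m*n≢0 n n
    nonZero-Kn² : NonZero (K * (n * n))
    nonZero-Kn² = m*n≢0 K (n * n)
    nonZero-Z : NonZero Z
    nonZero-Z = >-nonZero (<-≤-trans (>-nonZero⁻¹ (K * (n * n))) K≤Z)

^-distribʳ-* : ∀ a b n → (a * b) ^ n ≡ a ^ n * b ^ n
^-distribʳ-* a b zero    = refl
^-distribʳ-* a b (suc n) = trans (cong (a * b *_) (^-distribʳ-* a b n))
  (solve 4 (λ a b x y → a :* b :* (x :* y) := a :* x :* (b :* y)) refl a b (a ^ n) (b ^ n))
  where open +-*-Solver

-- Three factors 3 are grouped with one factor 2: 2 * 27 = 54 ≤ 64 = 4³.
2^q*3^m≤4^m : ∀ q {m} → 3 * q ≤ m → 2 ^ q * 3 ^ m ≤ 4 ^ m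
2^q*3^m≤4^m q {m} 3q≤m = begin
  2 ^ q * 3 ^ m                    ≡⟨ cong (λ m → 2 ^ q * 3 ^ m) m≡ ⟩
  2 ^ q * 3 ^ (3 * q + r)          ≡⟨ cong (2 ^ q *_)
      (trans (^-distribˡ-+-* 3 (3 * q) r) (cong (_* 3 ^ r) (sym (^-*-assoc 3 3 q)))) ⟩
  2 ^ q * (27 ^ q * 3 ^ r)         ≡⟨ sym (*-assoc (2 ^ q) (27 ^ q) (3 ^ r)) ⟩
  2 ^ q * 27 ^ q * 3 ^ r           ≡⟨ cong (_* 3 ^ r) (sym (^-distribʳ-* 2 27 q)) ⟩
  54 ^ q * 3 ^ r                   ≤⟨ *-mono-≤ (^-monoˡ-≤ q (m≤m+n 54 10)) (^-monoˡ-≤ r (n≤1+n 3)) ⟩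
  64 ^ q * 4 ^ r                   ≡⟨ cong (_* 4 ^ r) (^-*-assoc 4 3 q) ⟩
  4 ^ (3 * q) * 4 ^ r              ≡⟨ sym (^-distribˡ-+-* 4 (3 * q) r) ⟩
  4 ^ (3 * q + r)                  ≡⟨ cong (4 ^_) (sym m≡) ⟩
  4 ^ m                            ∎
  where
  open ≤-Reasoning
  r = m ∸ 3 * q
  m≡ : m ≡ 3 * q + r
  m≡ = sym (m+[n∸m]≡n 3q≤m)

n<2^n : ∀ n → n < 2 ^ n
n<2^n zero    = s≤s z≤n
n<2^n (suc n) = begin
  suc (suc n)      ≤⟨ s≤s (n<2^n n) ⟩
  suc (2 ^ n)      ≤⟨ +-monoˡ-≤ (2 ^ n) (m^n>0 2 n) ⟩
  2 ^ n + 2 ^ n    ≡⟨ cong (_+_ (2 ^ n)) (sym (+-identityʳ (2 ^ n))) ⟩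
  2 * 2 ^ n        ∎
  where open ≤-Reasoning

-- e = 3 ⌊n/16⌋.
exponent-exists : ∀ C .{{_ : NonZero C}} n → 256 * C * 16 ≤ n → ∃ λ e → 4 * e + 2 ≤ n × C * (n * n) ≤ 2 ^ e
exponent-exists C n large = 3 * s , small , (begin
  C * (n * n)                        ≤⟨ *-monoʳ-≤ C (*-mono-≤ n≤ n≤) ⟩
  C * ((suc s * 16) * (suc s * 16))  ≡⟨ solve 2
      (λ c t → c :* ((t :* con 16) :* (t :* con 16)) := (con 256 :* c) :* (t :* t)) refl C (suc s) ⟩
  -- One of the three factors `2 ^ s` absorbs 256 C, the other two absorb s + 1 each.
  256 * C * (suc s * suc s)          ≤⟨ *-mono-≤ (≤-trans C≤s (<⇒≤ (n<2^n s)))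
      (*-mono-≤ (n<2^n s) (n<2^n s)) ⟩
  2 ^ s * (2 ^ s * 2 ^ s)            ≡⟨ cong (2 ^ s *_) (sym (^-distribˡ-+-* 2 s s)) ⟩
  2 ^ s * 2 ^ (s + s)                ≡⟨ sym (^-distribˡ-+-* 2 s (s + s)) ⟩
  2 ^ (s + (s + s))                  ≡⟨ cong (2 ^_) (solve 1 (λ s → s :+ (s :+ s) := con 3 :* s) refl s) ⟩
  2 ^ (3 * s)                        ∎)
  where
  open ≤-Reasoning
  open +-*-Solver
  s = n / 16
  C≤s : 256 * C ≤ s
  C≤s = subst (_≤ s) (m*n/n≡m (256 * C) 16) (/-monoˡ-≤ 16 large)
  1≤s : 1 ≤ s
  1≤s = ≤-trans (>-nonZero⁻¹ (256 * C) {{m*n≢0 256 C}}) C≤s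
  n≤ : n ≤ suc s * 16
  n≤ = begin
    n                  ≡⟨ m≡m%n+[m/n]*n n 16 ⟩
    n % 16 + s * 16    ≤⟨ +-monoˡ-≤ (s * 16) (<⇒≤ (m%n<n n 16)) ⟩
    16 + s * 16        ∎
  small : 4 * (3 * s) + 2 ≤ n
  small = begin
    4 * (3 * s) + 2         ≤⟨ +-monoʳ-≤ (4 * (3 * s)) (≤-trans (m≤m+n 2 2) (*-monoʳ-≤ 4 1≤s)) ⟩
    4 * (3 * s) + 4 * s     ≡⟨ solve 1 (λ s → con 4 :* (con 3 :* s) :+ con 4 :* s := s :* con 16) refl s ⟩
    s * 16                  ≤⟨ m/n*n≤m n 16 ⟩
    n                       ∎

-- `Y` stands for Xⁿ, `W` for the pairs, `L` for all labelled graphs, `B` for the far ones and `T`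
-- for (X + n)ⁿ. Each of the two error terms is at most L/(2M), so W ≤ L/M.
absorb : ∀ M {Y W L B T} .{{_ : NonZero Y}} → Y * W + L * Y ≤ Y * B + L * T →
  2 * M * B ≤ L → 2 * M * T ≤ suc (2 * M) * Y → M * W ≤ L
absorb M {Y} {W} {L} {B} {T} main farBound powBound = *-cancelʳ-≤ (M * W) L (2 * Y) {{m*n≢0 2 Y}}
    (+-cancelʳ-≤ (2 * M * (L * Y)) _ _ (begin
  M * W * (2 * Y) + 2 * M * (L * Y)    ≡⟨ solve 4
      (λ m w y l → m :* w :* (con 2 :* y) :+ con 2 :* m :* (l :* y) := con 2 :* m :*
      (y :* w :+ l :* y)) refl M W Y L ⟩
  2 * M * (Y * W + L * Y)              ≤⟨ *-monoʳ-≤ (2 * M) main ⟩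
  2 * M * (Y * B + L * T)              ≡⟨ solve 5
      (λ m y b l t → con 2 :* m :* (y :* b :+ l :* t) := y :* (con 2 :* m :* b) :+ l :*
      (con 2 :* m :* t)) refl M Y B L T ⟩
  Y * (2 * M * B) + L * (2 * M * T)    ≤⟨ +-mono-≤ (*-monoʳ-≤ Y farBound) (*-monoʳ-≤ L powBound) ⟩
  Y * L + L * (suc (2 * M) * Y)        ≡⟨ solve 3
      (λ m y l → y :* l :+ l :* ((con 1 :+ con 2 :* m) :* y) := l :* (con 2 :* y) :+ con 2 :* m :*
      (l :* y)) refl M Y L ⟩
  L * (2 * Y) + 2 * M * (L * Y)        ∎))
  where
  open ≤-Reasoning
  open +-*-Solver

-- In `count-far`, M n² is at most `2 ^ e`, and `2 ^ e * 3 ^ m` at most `4 ^ m` because 3e ≤ m; the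
-- total 2 * 4 ^ m * 2 ^ `tri m` also pays for the factor 2.
far-≤ : ∀ M m {e} → 4 * e + 2 ≤ 2 + m → M * ((2 + m) * (2 + m)) ≤ 2 ^ e →
  2 * M * length (filter (far? (2 + m)) (codes (2 + m))) ≤ 2 ^ tri (2 + m)
far-≤ M m {e} 4e+2≤n big = begin
  2 * M * length (filter (far? (2 + m)) (codes (2 + m)))
    ≤⟨ *-monoʳ-≤ (2 * M) (FarGraphs.count-far m) ⟩
  2 * M * ((2 + m) * (1 + m) * (3 ^ m * t))
    ≡⟨ solve 5 (λ M a b p t → con 2 :* M :* (a :* b :* (p :* t)) := con 2 :* ((M :* (a :* b)) :* p) :*
        t) refl M (2 + m) (1 + m) (3 ^ m) t ⟩
  2 * ((M * ((2 + m) * (1 + m))) * 3 ^ m) * t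
    ≤⟨ *-monoˡ-≤ t (*-monoʳ-≤ 2 (*-monoˡ-≤ (3 ^ m)
        (≤-trans (*-monoʳ-≤ M (*-monoʳ-≤ (2 + m) (n≤1+n (1 + m)))) big))) ⟩
  2 * (2 ^ e * 3 ^ m) * t
    ≤⟨ *-monoˡ-≤ t (*-monoʳ-≤ 2 (2^q*3^m≤4^m e 3e≤m)) ⟩
  2 * 4 ^ m * t
    ≡⟨ cong (λ z → 2 * z * t) (^-distribʳ-* 2 2 m) ⟩
  2 * (2 ^ m * 2 ^ m) * t
    ≡⟨ solve 2 (λ a t → con 2 :* (a :* a) :* t := con 2 :* (a :* (a :* t))) refl (2 ^ m) t ⟩
  2 * (2 ^ m * (2 ^ m * t))
    ≡⟨ cong (2 *_) (trans (cong (2 ^ m *_) (sym (^-distribˡ-+-* 2 m (tri m))))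
        (sym (^-distribˡ-+-* 2 m (m + tri m)))) ⟩
  2 ^ tri (2 + m) ∎
  where
  open ≤-Reasoning
  open +-*-Solver
  t = 2 ^ tri m
  3e≤m : 3 * e ≤ m
  3e≤m = ≤-trans (*-monoˡ-≤ e (n≤1+n 3)) (+-cancelʳ-≤ 2 (4 * e) m
      (subst (4 * e + 2 ≤_) (+-comm 2 m) 4e+2≤n))

-- Isomorphism classes

classes*perms-nonZero : ∀ n {g} → HasCardinality (𝒢 n) g → NonZero (g * length (perms n))
classes*perms-nonZero n card = >-nonZero (≤-trans (m^n>0 2 (tri n)) (codes≤classes*perms n card))

-- Burnside's inequality for representatives of the unique classes: a labelled graph isomorphic to
-- one of them cannot have diameter at most two.
uniqueClasses*perms≤ : ∀ n {u} → HasCardinality (U χ-harm (3 + n)) u →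
  u * length (perms (3 + n)) ≤ length (filter (automorphicFar? (3 + n))
      (cartesianProduct (maps (3 + n)) (codes (3 + n))))
uniqueClasses*perms≤ n {u} card = BurnsideInequality.burnside-≤ (3 + n) (λ i → proj₁ (R.to i))
    (λ {i} {j} → R.injective {i} {j}) (automorphicFar? (3 + n))
  (λ i α v Ri≅v auto → auto , λ diam → unique⇒¬diameter≤2 n (proj₁ (R.to i)) (proj₂ (R.to i))
      (diameter≤2-≅ {G = proj₁ (R.to i)} {decode (3 + n) v} Ri≅v diam))
  where module R = Bijection card

-- With p permutations the chain is M u p ≤ M W ≤ `2 ^ tri n` ≤ g p, and p cancels.
uniqueClasses-≤ : ∀ M .{{_ : NonZero M}} k e → 4 * e + 2 ≤ 3 + k → suc (2 * M) * ((3 + k) * (3 + k)) ≤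
    2 ^ e →
  ∀ {u g} → HasCardinality (U χ-harm (3 + k)) u → HasCardinality (𝒢 (3 + k)) g → M * u ≤ g
uniqueClasses-≤ M k e 4e+2≤n big {u} {g} U-card 𝒢-card = *-cancelʳ-≤ (M * u) g p
    {{m*n≢0⇒n≢0 g {{classes*perms-nonZero n 𝒢-card}}}} (begin
  M * u * p        ≡⟨ *-assoc M u p ⟩
  M * (u * p)      ≤⟨ *-monoʳ-≤ M (uniqueClasses*perms≤ k U-card) ⟩
  M * W            ≤⟨ absorb M {Y = (2 ^ e) ^ n} {W = W} {{m^n≢0 (2 ^ e) n {{m^n≢0 2 e}}}}
      (automorphicPairs-≤ n e 4e+2≤n)
                        (far-≤ M (1 + k) {e} 4e+2≤n (≤-trans (*-monoˡ-≤ (n * n) M≤) big))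
                        (pow-+-≤ (2 * M) n (2 ^ e) {{m*n≢0 2 M}} big) ⟩
  2 ^ tri n        ≤⟨ codes≤classes*perms n 𝒢-card ⟩
  g * p            ∎)
  where
  open ≤-Reasoning
  n = 3 + k
  p = length (perms n)
  W = length (filter (automorphicFar? n) (cartesianProduct (maps n) (codes n)))
  M≤ : M ≤ suc (2 * M)
  M≤ = ≤-trans (m≤m+n M (M + 0)) (n≤1+n (2 * M))

unique-rare : ∀ M .{{_ : NonZero M}} → ∃ λ N → ∀ n → N ≤ n → ∀ {u g} →
  HasCardinality (U χ-harm n) u → HasCardinality (𝒢 n) g → M * u ≤ g
-- The summand 3 gives n the form 3 + k, where star and complete graph differ; the rest is the
-- threshold of `exponent-exists` for C = 2M + 1.
unique-rare M = 3 + 256 * suc (2 * M) * 16 , λ n N≤n → subst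
  (λ n → ∀ {u g} → HasCardinality (U χ-harm n) u → HasCardinality (𝒢 n) g → M * u ≤ g)
  (m+[n∸m]≡n (≤-trans (m≤m+n 3 (256 * suc (2 * M) * 16)) N≤n))
  (let e , 4e+2≤n , big = exponent-exists (suc (2 * M)) (3 + (n ∸ 3))
         (subst (256 * suc (2 * M) * 16 ≤_)
             (sym (m+[n∸m]≡n (≤-trans (m≤m+n 3 (256 * suc (2 * M) * 16)) N≤n)))
             (≤-trans (m≤n+m (256 * suc (2 * M) * 16) 3) N≤n))
   in uniqueClasses-≤ M (n ∸ 3) e 4e+2≤n big)

-- A positive ε with denominator d + 1 is at least 1/(d + 1). The extra factor 2 in the hypothesis
-- makes the inequality strict.
ratio-< : ∀ u g .{{_ : NonZero g}} (ε : ℚ) → 0ℚ ℚ.< ε → (suc (ℚ.ℚ.denominator-1 ε) * 2) * u ≤ g →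
  ℚ.∣ (ℤ.+ u ℚ./ g) ℚ.- 0ℚ ∣ ℚ.< ε
ratio-< u (suc g) ε@(mkℚ a d _) 0<ε bound = subst (ℚ._< ε) (sym abs) (ℚ.toℚᵘ-cancel-<
  (ℚᵘ.<-respˡ-≃ (ℚᵘ.≃-sym (ℚ.toℚᵘ-fromℚᵘ (mkℚᵘ (ℤ.+ u) g)))
      (ℚᵘ.*<* (cross (subst (ℤ.+ 0 ℤ.<_) (ℤ.*-identityʳ a) (ℚ.drop-*<* 0<ε))))))
  where
  q = ℤ.+ u ℚ./ suc g
  abs : ℚ.∣ q ℚ.- 0ℚ ∣ ≡ q
  abs = trans (cong ℚ.∣_∣ (ℚ.+-identityʳ q))
      (ℚ.0≤p⇒∣p∣≡p (ℚ.nonNegative⁻¹ q {{ℚ.normalize-nonNeg u (suc g)}}))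
  half : u * suc d < suc g
  half = *-cancelʳ-< 2 (u * suc d) (suc g) (begin-strict
    u * suc d * 2     ≡⟨ trans (*-assoc u (suc d) 2) (*-comm u (suc d * 2)) ⟩
    suc d * 2 * u     ≤⟨ bound ⟩
    suc g             <⟨ m<m*n (suc g) 2 (s≤s (s≤s z≤n)) ⟩
    suc g * 2         ∎)
    where open ≤-Reasoning
  cross : ∀ {a} → ℤ.+ 0 ℤ.< a → ℤ.+ u ℤ.* ℤ.+ suc d ℤ.< a ℤ.* ℤ.+ suc g
  cross {ℤ.+ a} (ℤ.+<+ 0<a) = subst₂ ℤ._<_ (ℤ.pos-* u (suc d)) (ℤ.pos-* a (suc g))
    (ℤ.+<+ (<-≤-trans half (m≤n*m (suc g) a {{>-nonZero 0<a}})))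

theorem4 : WeaklyDistinguishing χ-harm
theorem4 = record
  { ∣U∣         = λ n → proj₁ (U-finite n)
  ; ∣𝒢∣         = λ n → proj₁ (𝒢-finite n)
  ; ∣U∣-correct = λ n → proj₂ (U-finite n)
  ; ∣𝒢∣-correct = λ n → proj₂ (𝒢-finite n)
  ; ∣𝒢∣-nonZero = nonZero
  ; ratio→0     = λ ε 0<ε →
      let N , rare = unique-rare (suc (ℚ.ℚ.denominator-1 ε) * 2)
      in N , λ n N≤n → ratio-< (proj₁ (U-finite n)) (proj₁ (𝒢-finite n)) {{nonZero n}} ε 0<ε
           (rare n N≤n (proj₂ (U-finite n)) (proj₂ (𝒢-finite n)))
  }
  where
  nonZero : ∀ n → NonZero (proj₁ (𝒢-finite n))
  nonZero n = m*n≢0⇒m≢0 (proj₁ (𝒢-finite n)) {{classes*perms-nonZero n (proj₂ (𝒢-finite n))}}
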